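{- (1) The operators $\psi_k,\psi^*_k$ ($k\in\mathbb Z$) on $\mathcal B$ satisfy the relations of the Clifford algebra of fermions: for all $k,l\in\mathbb Z$, $$\psi_k\psi_l+\psi_l\psi_k=0,\qquad \psi^*_k\psi^*_l+\psi^*_l\psi^*_k=0,\qquad \psi_k\psi^*_l+\psi^*_l\psi_k=\delta_{k,l}.$$ (2) Let $\lambda=(\lambda_1\ge\lambda_2\ge\dots\ge\lambda_l)$ be a partition with $|\lambda|=\sum_i\lambda_i$, and let $\mu$ be the conjugate partition of $\lambda$. Then $$\psi_{\lambda_1+l}\,\psi_{\lambda_2+l-1}\cdots\psi_{\lambda_{l-1}+2}\,\psi_{\lambda_l+1}(1)=s_\lambda z^l,$$ $$\psi^*_{ -\lambda_1-l+1}\cdots\psi^*_{ -\lambda_{l-1}-1}\,\psi^*_{ -\lambda_l}(1)=(-1)^{|\lambda|}s_\mu z^{ -l}.$$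
   Context: Setting. Let $B=\mathbb C[h^{(0)}_1,h^{(0)}_2,\dots]$ be the polynomial ring in independent variables $h^{(0)}_k$ ($k>0$), with $h^{(0)}_0=1$ and $h^{(0)}_k=0$ for $k<0$. $B$ is graded by $\deg h^{(0)}_n=n$, and $B^{\le n}$ is the sum of the homogeneous components of degree $\le n$. Let $\{h^{(r)}_k\}_{k,r\in\mathbb Z}$ be a family of elements of $B$ (extending the $h^{(0)}_k$) with $h^{(r)}_k\in B^{\le k+r}$, $h^{(k)}_{ -k}=1$ for all $k\in\mathbb Z$, and $h^{(r)}_k=0$ whenever $k+r<0$. For an integer vector $\lambda=(\lambda_1,\dots,\lambda_l)$ (parts may be negative and in any order), extended by $\lambda_i=0$ for $i>l$, let $s_\lambda\in B$ be the stable value, for large $N$, of $\det\left[h^{(j-1)}_{\lambda_i-i+1}\right]_{1\le i,j\le N}$ (the value is the same for all $N\ge l$). For partitions these are the generalized Schur functions, and it is required that $\{s_\lambda\}$, $\lambda$ ranging over all partitions, is a linear basis of $B$. Let $z$ be a variable, $\mathcal B^{(m)}=z^mB$, $\mathcal B=\bigoplus_{m\in\mathbb Z}\mathcal B^{(m)}=B[z,z^{ -1}]$, with linear basis $\{s_\lambda z^m\}$ ($\lambda$ a partition, $m\in\mathbb Z$). The linear operators $\psi_k,\psi_k^*$ on $\mathcal B$ are defined on this basis by $$\psi_k(s_\lambda z^m)=s_{(k-m-1,\lambda_1,\lambda_2,\dots)}z^{m+1},$$ $$\psi^*_k(s_\lambda z^m)=\sum_{t=1}^\infty(-1)^{t+1}\delta_{k-m-1,\,\lambda_t-t}\;s_{(\lambda_1+1,\dots,\lambda_{t-1}+1,\lambda_{t+1},\lambda_{t+2},\dots)}z^{m-1},$$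 where $\lambda_t=0$ for $t$ larger than the number of parts of $\lambda$. -}

module Defs where

open import Algebra.Bundles using (CommutativeRing; CommutativeMonoid)
open import Algebra.Morphism.Structures using (IsRingHomomorphism)
open import Algebra.Module.Bundles using (LeftModule)
import Algebra.Module.Construct.TensorUnit as TensorUnit
open import Algebra.Module.Morphism.Structures using (module LeftModuleMorphisms)
import Algebra.Properties.CommutativeMonoid.Sum as Sum
import Algebra.Properties.CommutativeSemigroup as CommutativeSemigroupProperties
import Algebra.Properties.Group as GroupProperties
import Algebra.Properties.Semiring.Exp as Exp
open import Data.Bool.Base using (if_then_else_)
open import Data.Empty using (⊥-elim)
open import Data.Fin.Base using (Fin; zero; suc; toℕ; punchIn)
open import Data.Integer.Base as ℤ using (ℤ; +_; -[1+_])
import Data.Integer.Properties as ℤₚ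
open import Data.List.Base as List
  using (List; []; _∷_; _++_; [_]; map; length; filter; applyUpTo; foldr)
import Data.List.Properties as Listₚ
open import Data.List.Relation.Unary.All using (All)
open import Data.List.Relation.Unary.Linked using (Linked)
open import Data.Nat.Base as ℕ using (ℕ; zero; suc)
import Data.Nat.Properties as ℕₚ
open import Data.Product.Base using (_×_; _,_; proj₁; proj₂; ∃)
open import Data.Product.Relation.Binary.Pointwise.NonDependent using (×-decSetoid)
open import Function.Base using (_∘_)
open import Level using (Level; _⊔_; 0ℓ)
open import Relation.Binary.Bundles using (DecSetoid)
import Relation.Binary.Construct.On as On
open import Relation.Binary.Definitions using (Decidable)
open import Relation.Binary.PropositionalEquality as ≡ using (_≡_)
import Relation.Binary.Reasoning.Setoid as SetoidReasoning
open import Relation.Nullary using (¬_; yes; no; does)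
open import Relation.Nullary.Decidable using (map′; _×-dec_)

private variable
  c ℓ i ℓi m ℓm : Level

-- Finite formal sums Σ aₙ [xₙ], identified when all coefficients agree; an index may repeat.
module FormalSum (R : CommutativeRing c ℓ) (I : DecSetoid i ℓi) where
  private
    module R = CommutativeRing R
    module I = DecSetoid I

  R-module : LeftModule R.ring c ℓ
  R-module = TensorUnit.leftModule {R = R.ring}

  FormalSum : Set (c ⊔ i)
  FormalSum = List (R.Carrier × I.Carrier)

  module _ (M : LeftModule R.ring m ℓm) where
    open LeftModule M

    linearCombination : (I.Carrier → Carrierᴹ) → FormalSum → Carrierᴹ
    linearCombination f []             = 0ᴹ
    linearCombination f ((a , x) ∷ xs) = a *ₗ f x +ᴹ linearCombination f xs

  indicator : I.Carrier → I.Carrier → R.Carrier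
  indicator x y = if does (x I.≟ y) then R.1# else R.0#

  coeff : FormalSum → I.Carrier → R.Carrier
  coeff xs x = linearCombination R-module (indicator x) xs

  infix 4 _≈_
  record _≈_ (xs ys : FormalSum) : Set (i ⊔ ℓ) where
    constructor coeffwise
    field coeff≈ : ∀ x → coeff xs x R.≈ coeff ys x
  open _≈_ public

  infixr 7 _•_
  _•_ : R.Carrier → FormalSum → FormalSum
  a • xs = map (λ (b , x) → (a R.* b , x)) xs

  neg : FormalSum → FormalSum
  neg = map (λ (b , x) → (R.- b , x))

  module _ (M : LeftModule R.ring m ℓm) where
    open LeftModule M
    open SetoidReasoning ≈ᴹ-setoid
    open CommutativeSemigroupProperties
      (CommutativeMonoid.commutativeSemigroup +ᴹ-commutativeMonoid)
      using (interchange; x∙yz≈y∙xz)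
    private lc = linearCombination M

    lc-++ : ∀ f xs ys → lc f (xs ++ ys) ≈ᴹ lc f xs +ᴹ lc f ys
    lc-++ f []             ys = ≈ᴹ-sym (+ᴹ-identityˡ _)
    lc-++ f ((a , x) ∷ xs) ys =
      ≈ᴹ-trans (+ᴹ-congˡ (lc-++ f xs ys)) (≈ᴹ-sym (+ᴹ-assoc _ _ _))

    lc-• : ∀ f a xs → lc f (a • xs) ≈ᴹ a *ₗ lc f xs
    lc-• f a []             = ≈ᴹ-sym (*ₗ-zeroʳ a)
    lc-• f a ((b , x) ∷ xs) = begin
      (a R.* b) *ₗ f x +ᴹ lc f (a • xs) ≈⟨ +ᴹ-cong (*ₗ-assoc a b (f x)) (lc-• f a xs) ⟩
      a *ₗ (b *ₗ f x) +ᴹ a *ₗ lc f xs   ≈⟨ *ₗ-distribˡ a _ _ ⟨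
      a *ₗ (b *ₗ f x +ᴹ lc f xs)        ∎

    lc-neg : ∀ f xs → lc f xs +ᴹ lc f (neg xs) ≈ᴹ 0ᴹ
    lc-neg f []             = +ᴹ-identityˡ _
    lc-neg f ((b , x) ∷ xs) = begin
      (b *ₗ f x +ᴹ lc f xs) +ᴹ ((R.- b) *ₗ f x +ᴹ lc f (neg xs))
        ≈⟨ interchange _ _ _ _ ⟩
      (b *ₗ f x +ᴹ (R.- b) *ₗ f x) +ᴹ (lc f xs +ᴹ lc f (neg xs))
        ≈⟨ +ᴹ-cong (≈ᴹ-sym (*ₗ-distribʳ (f x) b (R.- b))) (lc-neg f xs) ⟩
      (b R.+ R.- b) *ₗ f x +ᴹ 0ᴹ
        ≈⟨ +ᴹ-congʳ (*ₗ-congʳ (R.-‿inverseʳ b)) ⟩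
      R.0# *ₗ f x +ᴹ 0ᴹ
        ≈⟨ +ᴹ-identityʳ _ ⟩
      R.0# *ₗ f x
        ≈⟨ *ₗ-zeroˡ (f x) ⟩
      0ᴹ ∎

    lc-ext : ∀ {f g} → (∀ x → f x ≈ᴹ g x) → ∀ xs → lc f xs ≈ᴹ lc g xs
    lc-ext f≈g []             = ≈ᴹ-refl
    lc-ext f≈g ((a , x) ∷ xs) = +ᴹ-cong (*ₗ-congˡ (f≈g x)) (lc-ext f≈g xs)

    lc-single : ∀ f x → lc f [ R.1# , x ] ≈ᴹ f x
    lc-single f x = ≈ᴹ-trans (+ᴹ-identityʳ _) (*ₗ-identityˡ (f x))

    lc-0 : ∀ xs → lc (λ _ → 0ᴹ) xs ≈ᴹ 0ᴹ
    lc-0 []             = ≈ᴹ-refl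
    lc-0 ((a , x) ∷ xs) = ≈ᴹ-trans (+ᴹ-cong (*ₗ-zeroʳ a) (lc-0 xs)) (+ᴹ-identityˡ _)

    lc-+ : ∀ f g xs → lc (λ x → f x +ᴹ g x) xs ≈ᴹ lc f xs +ᴹ lc g xs
    lc-+ f g []             = ≈ᴹ-sym (+ᴹ-identityˡ _)
    lc-+ f g ((a , x) ∷ xs) =
      ≈ᴹ-trans (+ᴹ-cong (*ₗ-distribˡ a _ _) (lc-+ f g xs)) (interchange _ _ _ _)

    lc-scale : ∀ f a xs → lc (λ x → a *ₗ f x) xs ≈ᴹ a *ₗ lc f xs
    lc-scale f a []             = ≈ᴹ-sym (*ₗ-zeroʳ a)
    lc-scale f a ((b , x) ∷ xs) = begin
      b *ₗ (a *ₗ f x) +ᴹ lc (λ x → a *ₗ f x) xs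
        ≈⟨ +ᴹ-cong (≈ᴹ-sym (*ₗ-assoc b a (f x))) (lc-scale f a xs) ⟩
      (b R.* a) *ₗ f x +ᴹ a *ₗ lc f xs
        ≈⟨ +ᴹ-congʳ (*ₗ-congʳ (R.*-comm b a)) ⟩
      (a R.* b) *ₗ f x +ᴹ a *ₗ lc f xs
        ≈⟨ +ᴹ-congʳ (*ₗ-assoc a b (f x)) ⟩
      a *ₗ (b *ₗ f x) +ᴹ a *ₗ lc f xs
        ≈⟨ *ₗ-distribˡ a _ _ ⟨
      a *ₗ (b *ₗ f x +ᴹ lc f xs) ∎

    private
      remove : I.Carrier → FormalSum → FormalSum
      remove y []             = []
      remove y ((a , x) ∷ xs) with y I.≟ x
      ... | yes _ = remove y xs
      ... | no  _ = (a , x) ∷ remove y xs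

      length-remove : ∀ y xs → length (remove y xs) ℕ.≤ length xs
      length-remove y []             = ℕ.z≤n
      length-remove y ((a , x) ∷ xs) with y I.≟ x
      ... | yes _ = ℕₚ.m≤n⇒m≤1+n (length-remove y xs)
      ... | no  _ = ℕ.s≤s (length-remove y xs)

      length-remove-head : ∀ a x xs → length (remove x ((a , x) ∷ xs)) ℕ.≤ length xs
      length-remove-head a x xs with x I.≟ x
      ... | yes _  = length-remove x xs
      ... | no x≉x = ⊥-elim (x≉x I.refl)

      Respects : (I.Carrier → Carrierᴹ) → Set _
      Respects f = ∀ {x y} → x I.≈ y → f x ≈ᴹ f y

      lc-remove : ∀ f → Respects f → ∀ y xs →
                  lc f xs ≈ᴹ coeff xs y *ₗ f y +ᴹ lc f (remove y xs)
      lc-remove f resp y [] = begin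
        0ᴹ                  ≈⟨ *ₗ-zeroˡ (f y) ⟨
        R.0# *ₗ f y         ≈⟨ +ᴹ-identityʳ _ ⟨
        R.0# *ₗ f y +ᴹ 0ᴹ   ∎
      lc-remove f resp y ((a , x) ∷ xs) with y I.≟ x
      ... | yes y≈x = begin
        a *ₗ f x +ᴹ lc f xs
          ≈⟨ +ᴹ-cong (*ₗ-cong (R.sym (R.*-identityʳ a)) (resp (I.sym y≈x)))
                     (lc-remove f resp y xs) ⟩
        (a R.* R.1#) *ₗ f y +ᴹ (coeff xs y *ₗ f y +ᴹ lc f (remove y xs))
          ≈⟨ +ᴹ-assoc _ _ _ ⟨
        ((a R.* R.1#) *ₗ f y +ᴹ coeff xs y *ₗ f y) +ᴹ lc f (remove y xs)
          ≈⟨ +ᴹ-congʳ (*ₗ-distribʳ (f y) _ _) ⟨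
        (a R.* R.1# R.+ coeff xs y) *ₗ f y +ᴹ lc f (remove y xs) ∎
      ... | no _ = begin
        a *ₗ f x +ᴹ lc f xs
          ≈⟨ +ᴹ-congˡ (lc-remove f resp y xs) ⟩
        a *ₗ f x +ᴹ (coeff xs y *ₗ f y +ᴹ lc f (remove y xs))
          ≈⟨ x∙yz≈y∙xz _ _ _ ⟩
        coeff xs y *ₗ f y +ᴹ (a *ₗ f x +ᴹ lc f (remove y xs))
          ≈⟨ +ᴹ-congʳ (*ₗ-congʳ (R.trans (R.+-congʳ (R.zeroʳ a)) (R.+-identityˡ _))) ⟨
        (a R.* R.0# R.+ coeff xs y) *ₗ f y +ᴹ (a *ₗ f x +ᴹ lc f (remove y xs)) ∎

    private
      coeff-remove-same : ∀ {x} y xs → y I.≈ x → coeff (remove y xs) x R.≈ R.0#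
      coeff-remove-same y [] y≈x = R.refl
      coeff-remove-same {x} y ((a , z) ∷ xs) y≈x with y I.≟ z
      ... | yes _ = coeff-remove-same y xs y≈x
      ... | no y≉z with x I.≟ z
      ...   | yes x≈z = ⊥-elim (y≉z (I.trans y≈x x≈z))
      ...   | no  _   = R.trans (R.+-cong (R.zeroʳ a) (coeff-remove-same y xs y≈x))
                                (R.+-identityˡ _)

      coeff-remove-other : ∀ {x} y xs → ¬ y I.≈ x → coeff (remove y xs) x R.≈ coeff xs x
      coeff-remove-other y [] y≉x = R.refl
      coeff-remove-other {x} y ((a , z) ∷ xs) y≉x with y I.≟ z
      coeff-remove-other {x} y ((a , z) ∷ xs) y≉x | no _ =
        R.+-congˡ (coeff-remove-other y xs y≉x)
      coeff-remove-other {x} y ((a , z) ∷ xs) y≉x | yes y≈z with x I.≟ z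
      ... | yes x≈z = ⊥-elim (y≉x (I.trans y≈z (I.sym x≈z)))
      ... | no _ = R.trans (coeff-remove-other y xs y≉x)
                     (R.sym (R.trans (R.+-congʳ (R.zeroʳ a)) (R.+-identityˡ _)))

      coeff-remove : ∀ y xs → (∀ x → coeff xs x R.≈ R.0#) →
                     ∀ x → coeff (remove y xs) x R.≈ R.0#
      coeff-remove y xs z x with y I.≟ x
      ... | yes y≈x = coeff-remove-same y xs y≈x
      ... | no  y≉x = R.trans (coeff-remove-other y xs y≉x) (z x)

      lc-zero′ : ∀ f → Respects f → ∀ n xs → length xs ℕ.≤ n →
                 (∀ x → coeff xs x R.≈ R.0#) → lc f xs ≈ᴹ 0ᴹ
      lc-zero′ f resp n       []             _         z = ≈ᴹ-refl
      lc-zero′ f resp (suc n) xs₀@((a , x) ∷ xs) (ℕ.s≤s l) z = begin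
        lc f xs₀
          ≈⟨ lc-remove f resp x xs₀ ⟩
        coeff xs₀ x *ₗ f x +ᴹ lc f (remove x xs₀)
          ≈⟨ +ᴹ-cong (*ₗ-congʳ (z x))
               (lc-zero′ f resp n (remove x xs₀)
                 (ℕₚ.≤-trans (length-remove-head a x xs) l) (coeff-remove x xs₀ z)) ⟩
        R.0# *ₗ f x +ᴹ 0ᴹ
          ≈⟨ +ᴹ-identityʳ _ ⟩
        R.0# *ₗ f x
          ≈⟨ *ₗ-zeroˡ (f x) ⟩
        0ᴹ ∎

    lc-zero : ∀ f → Respects f → ∀ xs → (∀ x → coeff xs x R.≈ R.0#) → lc f xs ≈ᴹ 0ᴹ
    lc-zero f resp xs = lc-zero′ f resp (length xs) xs ℕₚ.≤-refl

  coeff-++ : ∀ xs ys x → coeff (xs ++ ys) x R.≈ coeff xs x R.+ coeff ys x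
  coeff-++ xs ys x = lc-++ R-module (indicator x) xs ys

  coeff-• : ∀ a xs x → coeff (a • xs) x R.≈ a R.* coeff xs x
  coeff-• a xs x = lc-• R-module (indicator x) a xs

  coeff-neg : ∀ xs x → coeff xs x R.+ coeff (neg xs) x R.≈ R.0#
  coeff-neg xs x = lc-neg R-module (indicator x) xs

  module _ (M : LeftModule R.ring m ℓm) where
    open LeftModule M
    open SetoidReasoning ≈ᴹ-setoid
    private lc = linearCombination M

    lc-cong : ∀ f → (∀ {x y} → x I.≈ y → f x ≈ᴹ f y) →
              ∀ {xs ys} → xs ≈ ys → lc f xs ≈ᴹ lc f ys
    lc-cong f resp {xs} {ys} xs≈ys = begin
      lc f xs                                ≈⟨ +ᴹ-identityʳ _ ⟨
      lc f xs +ᴹ 0ᴹ                          ≈⟨ +ᴹ-congˡ (lc-neg M f ys) ⟨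
      lc f xs +ᴹ (lc f ys +ᴹ lc f (neg ys))  ≈⟨ +ᴹ-congˡ (+ᴹ-comm _ _) ⟩
      lc f xs +ᴹ (lc f (neg ys) +ᴹ lc f ys)  ≈⟨ +ᴹ-assoc _ _ _ ⟨
      (lc f xs +ᴹ lc f (neg ys)) +ᴹ lc f ys  ≈⟨ +ᴹ-congʳ (lc-++ M f xs (neg ys)) ⟨
      lc f (xs ++ neg ys) +ᴹ lc f ys         ≈⟨ +ᴹ-congʳ (lc-zero M f resp (xs ++ neg ys) zeros) ⟩
      0ᴹ +ᴹ lc f ys                          ≈⟨ +ᴹ-identityˡ _ ⟩
      lc f ys                                ∎
      where
      zeros : ∀ x → coeff (xs ++ neg ys) x R.≈ R.0#
      zeros x = R.trans (coeff-++ xs (neg ys) x)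
                  (R.trans (R.+-congʳ (coeff≈ xs≈ys x)) (coeff-neg ys x))

  ≈-refl : ∀ {xs} → xs ≈ xs
  ≈-refl = coeffwise λ _ → R.refl

  ≈-sym : ∀ {xs ys} → xs ≈ ys → ys ≈ xs
  ≈-sym p = coeffwise λ x → R.sym (coeff≈ p x)

  ≈-trans : ∀ {xs ys zs} → xs ≈ ys → ys ≈ zs → xs ≈ zs
  ≈-trans p q = coeffwise λ x → R.trans (coeff≈ p x) (coeff≈ q x)

  private
    ++-cong : ∀ {xs xs′ ys ys′} → xs ≈ xs′ → ys ≈ ys′ → xs ++ ys ≈ xs′ ++ ys′
    ++-cong {xs} {xs′} {ys} {ys′} p q = coeffwise λ x →
      R.trans (coeff-++ xs ys x)
        (R.trans (R.+-cong (coeff≈ p x) (coeff≈ q x)) (R.sym (coeff-++ xs′ ys′ x)))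

    ++-comm : ∀ xs ys → xs ++ ys ≈ ys ++ xs
    ++-comm xs ys = coeffwise λ x →
      R.trans (coeff-++ xs ys x)
        (R.trans (R.+-comm _ _) (R.sym (coeff-++ ys xs x)))

    ≡⇒≈ : ∀ {xs ys} → xs ≡ ys → xs ≈ ys
    ≡⇒≈ ≡.refl = ≈-refl

    neg-inverseʳ : ∀ xs → xs ++ neg xs ≈ []
    neg-inverseʳ xs = coeffwise λ x → R.trans (coeff-++ xs (neg xs) x) (coeff-neg xs x)

    neg-inverseˡ : ∀ xs → neg xs ++ xs ≈ []
    neg-inverseˡ xs = ≈-trans (++-comm (neg xs) xs) (neg-inverseʳ xs)

    neg-cong : ∀ {xs ys} → xs ≈ ys → neg xs ≈ neg ys
    neg-cong {xs} {ys} p = coeffwise λ x →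
      R.trans (inverseʳ-unique _ _ (coeff-neg xs x))
        (R.trans (R.-‿cong (coeff≈ p x))
          (R.sym (inverseʳ-unique _ _ (coeff-neg ys x))))
      where open GroupProperties R.+-group using (inverseʳ-unique)

  freeModule : LeftModule R.ring (c ⊔ i) (i ⊔ ℓ)
  freeModule = record
    { Carrierᴹ = FormalSum
    ; _≈ᴹ_ = _≈_
    ; _+ᴹ_ = _++_
    ; _*ₗ_ = _•_
    ; 0ᴹ   = []
    ; -ᴹ_  = neg
    ; isLeftModule = record
      { isLeftSemimodule = record
        { +ᴹ-isCommutativeMonoid = record
          { isMonoid = record
            { isSemigroup = record
              { isMagma = record
                { isEquivalence = record { refl = ≈-refl ; sym = ≈-sym ; trans = ≈-trans }
                ; ∙-cong = ++-cong
                }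
              ; assoc = λ xs ys zs → ≡⇒≈ (Listₚ.++-assoc xs ys zs)
              }
            ; identity = (λ xs → ≈-refl) , (λ xs → ≡⇒≈ (Listₚ.++-identityʳ xs))
            }
          ; comm = ++-comm
          }
        ; isPreleftSemimodule = record
          { *ₗ-cong = λ {a} {b} {xs} {ys} a≈b p → coeffwise λ x →
              R.trans (coeff-• a xs x)
                (R.trans (R.*-cong a≈b (coeff≈ p x)) (R.sym (coeff-• b ys x)))
          ; *ₗ-zeroˡ = λ xs → coeffwise λ x →
              R.trans (coeff-• R.0# xs x) (R.zeroˡ _)
          ; *ₗ-distribʳ = λ xs a b → coeffwise λ x →
              R.trans (coeff-• (a R.+ b) xs x)
                (R.trans (R.distribʳ _ a b)
                  (R.sym (R.trans (coeff-++ (a • xs) (b • xs) x)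
                    (R.+-cong (coeff-• a xs x) (coeff-• b xs x)))))
          ; *ₗ-identityˡ = λ xs → coeffwise λ x →
              R.trans (coeff-• R.1# xs x) (R.*-identityˡ _)
          ; *ₗ-assoc = λ a b xs → coeffwise λ x →
              R.trans (coeff-• (a R.* b) xs x)
                (R.trans (R.*-assoc a b _)
                  (R.sym (R.trans (coeff-• a (b • xs) x) (R.*-congˡ (coeff-• b xs x)))))
          ; *ₗ-zeroʳ = λ a → ≈-refl
          ; *ₗ-distribˡ = λ a xs ys → ≡⇒≈ (Listₚ.map-++ _ xs ys)
          }
        }
      ; -ᴹ‿cong = neg-cong
      ; -ᴹ‿inverse = neg-inverseˡ , neg-inverseʳ
      }
    }

  indicator-cong : ∀ z {x y} → x I.≈ y → indicator z x R.≈ indicator z y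
  indicator-cong z {x} {y} x≈y with z I.≟ x | z I.≟ y
  ... | yes _   | yes _   = R.refl
  ... | no  _   | no  _   = R.refl
  ... | yes z≈x | no z≉y  = ⊥-elim (z≉y (I.trans z≈x x≈y))
  ... | no z≉x  | yes z≈y = ⊥-elim (z≉x (I.trans z≈y (I.sym x≈y)))

  single : R.Carrier → I.Carrier → FormalSum
  single a x = [ a , x ]

  single-cong : ∀ {a b x y} → a R.≈ b → x I.≈ y → single a x ≈ single b y
  single-cong a≈b x≈y = coeffwise λ z →
    R.+-congʳ (R.*-cong a≈b (indicator-cong z x≈y))

  single-+ : ∀ a b x → single (a R.+ b) x ≈ single a x ++ single b x
  single-+ a b x = coeffwise λ z →
    R.trans (R.+-congʳ (R.distribʳ _ a b)) (R.+-assoc _ _ _)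

  single-0 : ∀ x → single R.0# x ≈ []
  single-0 x = coeffwise λ z → R.trans (R.+-identityʳ _) (R.zeroˡ _)

  lc-basis : ∀ xs → linearCombination freeModule (single R.1#) xs ≈ xs
  lc-basis []             = ≈-refl
  lc-basis ((a , x) ∷ xs) =
    ++-cong (single-cong (R.*-identityʳ a) I.refl) (lc-basis xs)

module _ (R : CommutativeRing c ℓ) (M : LeftModule (CommutativeRing.ring R) m ℓm)
         (I : DecSetoid i ℓi) where
  private
    module I = DecSetoid I
    module M = LeftModule M
  open FormalSum R I

  record IsBasis (v : I.Carrier → M.Carrierᴹ) : Set (c ⊔ ℓ ⊔ i ⊔ ℓi ⊔ m ⊔ ℓm) where
    field
      spanning    : ∀ u → ∃ λ xs → linearCombination M v xs M.≈ᴹ u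
      independent : ∀ xs → linearCombination M v xs M.≈ᴹ M.0ᴹ → xs ≈ []

module _ {R : CommutativeRing c ℓ} {M : LeftModule (CommutativeRing.ring R) m ℓm}
         {I : DecSetoid i ℓi} {v : DecSetoid.Carrier I → LeftModule.Carrierᴹ M}
         (basis : IsBasis R M I v)
         {n ℓn : Level} (N : LeftModule (CommutativeRing.ring R) n ℓn)
         (f : DecSetoid.Carrier I → LeftModule.Carrierᴹ N) where
  private
    module R = CommutativeRing R
    module I = DecSetoid I
    module M = LeftModule M
    module N = LeftModule N
  open IsBasis basis
  open FormalSum R I

  linearExtension : M.Carrierᴹ → N.Carrierᴹ
  linearExtension u = linearCombination N f (proj₁ (spanning u))

  module _ (f-cong : ∀ {x y} → x I.≈ y → f x N.≈ᴹ f y) where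

    linearExtension-combination : ∀ xs u → linearCombination M v xs M.≈ᴹ u →
                                  linearExtension u N.≈ᴹ linearCombination N f xs
    linearExtension-combination xs u p = lc-cong N f f-cong {us} {xs} (coeffwise λ x →
      GroupProperties.x∙y⁻¹≈ε⇒x≈y R.+-group _ _
        (R.trans (R.+-congˡ (R.sym (GroupProperties.inverseʳ-unique R.+-group _ _ (coeff-neg xs x))))
          (R.trans (R.sym (coeff-++ us (neg xs) x)) (coeff≈ (independent (us ++ neg xs) zero-sum) x))))
      where
      us = proj₁ (spanning u)
      zero-sum : linearCombination M v (us ++ neg xs) M.≈ᴹ M.0ᴹ
      zero-sum = M.≈ᴹ-trans (lc-++ M v us (neg xs))
        (M.≈ᴹ-trans (M.+ᴹ-congʳ (M.≈ᴹ-trans (proj₂ (spanning u)) (M.≈ᴹ-sym p)))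
          (lc-neg M v xs))

    linearExtension-basis : ∀ x → linearExtension (v x) N.≈ᴹ f x
    linearExtension-basis x =
      N.≈ᴹ-trans (linearExtension-combination [ R.1# , x ] (v x) (lc-single M v x))
                 (lc-single N f x)

    linearExtension-isHomomorphism :
      LeftModuleMorphisms.IsLeftModuleHomomorphism M.rawLeftModule N.rawLeftModule
        linearExtension
    linearExtension-isHomomorphism = record
      { +ᴹ-isGroupHomomorphism = record
        { isMonoidHomomorphism = record
          { isMagmaHomomorphism = record
            { isRelHomomorphism = record { cong = ext-cong }
            ; homo = ext-+
            }
          ; ε-homo = ext-0
          }
        ; ⁻¹-homo = λ u →
            GroupProperties.inverseʳ-unique N.+ᴹ-group _ _
              (N.≈ᴹ-trans (N.≈ᴹ-sym (ext-+ u (M.-ᴹ u)))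
                (N.≈ᴹ-trans (ext-cong (proj₂ M.-ᴹ‿inverse u)) ext-0))
        }
      ; *ₗ-homo = λ a u →
          N.≈ᴹ-trans
            (linearExtension-combination (a • proj₁ (spanning u)) (a M.*ₗ u)
              (M.≈ᴹ-trans (lc-• M v a (proj₁ (spanning u))) (M.*ₗ-congˡ (proj₂ (spanning u)))))
            (lc-• N f a (proj₁ (spanning u)))
      }
      where
      ext-cong : ∀ {u w} → u M.≈ᴹ w → linearExtension u N.≈ᴹ linearExtension w
      ext-cong {u} {w} p =
        linearExtension-combination (proj₁ (spanning w)) u
          (M.≈ᴹ-trans (proj₂ (spanning w)) (M.≈ᴹ-sym p))

      ext-+ : ∀ u w → linearExtension (u M.+ᴹ w) N.≈ᴹ linearExtension u N.+ᴹ linearExtension w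
      ext-+ u w = N.≈ᴹ-trans
        (linearExtension-combination (proj₁ (spanning u) ++ proj₁ (spanning w)) (u M.+ᴹ w)
          (M.≈ᴹ-trans (lc-++ M v (proj₁ (spanning u)) _)
            (M.+ᴹ-cong (proj₂ (spanning u)) (proj₂ (spanning w)))))
        (lc-++ N f (proj₁ (spanning u)) _)

      ext-0 : linearExtension M.0ᴹ N.≈ᴹ N.0ᴹ
      ext-0 = linearExtension-combination [] M.0ᴹ M.≈ᴹ-refl

module MonoidAlgebra (R : CommutativeRing c ℓ) (X : CommutativeMonoid i ℓi)
                     (_≟_ : Decidable (CommutativeMonoid._≈_ X)) where
  private
    module R = CommutativeRing R
    module X = CommutativeMonoid X

  decSetoid : DecSetoid i ℓi
  decSetoid = record
    { isDecEquivalence = record { isEquivalence = X.isEquivalence ; _≟_ = _≟_ } }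

  open FormalSum R decSetoid public
  private
    module F = LeftModule freeModule
    lc = linearCombination freeModule

  infixl 7 _*_
  _*_ : FormalSum → FormalSum → FormalSum
  p * q = lc (λ x → lc (λ y → single R.1# (x X.∙ y)) q) p

  private
    inner-cong : ∀ q {x x′} → x X.≈ x′ →
                 lc (λ y → single R.1# (x X.∙ y)) q ≈ lc (λ y → single R.1# (x′ X.∙ y)) q
    inner-cong q x≈x′ = lc-ext freeModule (λ y → single-cong R.refl (X.∙-congʳ x≈x′)) q

    *-cong : ∀ {p p′ q q′} → p ≈ p′ → q ≈ q′ → p * q ≈ p′ * q′
    *-cong {p} {p′} {q} {q′} p≈p′ q≈q′ = ≈-trans
      (lc-cong freeModule (λ x → lc (λ y → single R.1# (x X.∙ y)) q) (inner-cong q) p≈p′)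
      (lc-ext freeModule (λ x → lc-cong freeModule (λ y → single R.1# (x X.∙ y))
        (λ y≈y′ → single-cong R.refl (X.∙-congˡ y≈y′)) q≈q′) p′)

    lc-swap : ∀ (g : X.Carrier → X.Carrier → FormalSum) p q →
              lc (λ x → lc (λ y → g x y) q) p ≈ lc (λ y → lc (λ x → g x y) p) q
    lc-swap g []            q = ≈-sym (lc-0 freeModule q)
    lc-swap g ((a , x) ∷ p) q = ≈-trans
      (F.+ᴹ-cong (≈-sym (lc-scale freeModule (g x) a q)) (lc-swap g p q))
      (≈-sym (lc-+ freeModule (λ y → a • g x y) (λ y → lc (λ x → g x y) p) q))

    *-comm : ∀ p q → p * q ≈ q * p
    *-comm p q = ≈-trans (lc-swap (λ x y → single R.1# (x X.∙ y)) p q)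
      (lc-ext freeModule (λ y → lc-ext freeModule
        (λ x → single-cong R.refl (X.comm x y)) p) q)

    mono : X.Carrier → FormalSum
    mono = single R.1#

    lc-bind : ∀ f (g : X.Carrier → FormalSum) p → lc f (lc g p) ≈ lc (λ x → lc f (g x)) p
    lc-bind f g []            = ≈-refl
    lc-bind f g ((a , x) ∷ p) = ≈-trans (lc-++ freeModule f (a • g x) (lc g p))
      (F.+ᴹ-cong (lc-• freeModule f a (g x)) (lc-bind f g p))

    *-assoc : ∀ p q r → (p * q) * r ≈ p * (q * r)
    *-assoc p q r = ≈-trans
      (lc-bind (λ w → lc (λ z → mono (w X.∙ z)) r) (λ x → lc (λ y → mono (x X.∙ y)) q) p)
      (lc-ext freeModule (λ x → ≈-trans
        (lc-bind (λ w → lc (λ z → mono (w X.∙ z)) r) (λ y → mono (x X.∙ y)) q)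
        (≈-trans (lc-ext freeModule (expand x) q)
          (≈-sym (lc-bind (λ w → mono (x X.∙ w)) (λ y → lc (λ z → mono (y X.∙ z)) r) q)))) p)
      where
      expand : ∀ x y → lc (λ w → lc (λ z → mono (w X.∙ z)) r) (mono (x X.∙ y))
                     ≈ lc (λ w → mono (x X.∙ w)) (lc (λ z → mono (y X.∙ z)) r)
      expand x y = ≈-trans
        (lc-single freeModule (λ w → lc (λ z → mono (w X.∙ z)) r) (x X.∙ y))
        (≈-trans
          (lc-ext freeModule (λ z → ≈-trans (single-cong R.refl (X.assoc x y z))
            (≈-sym (lc-single freeModule (λ w → mono (x X.∙ w)) (y X.∙ z)))) r)
          (≈-sym (lc-bind (λ w → mono (x X.∙ w)) (λ z → mono (y X.∙ z)) r)))

    *-identityˡ : ∀ p → single R.1# X.ε * p ≈ p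
    *-identityˡ p = ≈-trans (lc-single freeModule (λ x → lc (λ y → mono (x X.∙ y)) p) X.ε)
      (≈-trans (lc-ext freeModule (λ y → single-cong R.refl (X.identityˡ y)) p) (lc-basis p))

    *-distribʳ : ∀ p q r → (q ++ r) * p ≈ (q * p) ++ (r * p)
    *-distribʳ p q r = lc-++ freeModule _ q r

    *-distribˡ : ∀ p q r → p * (q ++ r) ≈ (p * q) ++ (p * r)
    *-distribˡ p q r = ≈-trans (*-comm p (q ++ r))
      (≈-trans (*-distribʳ p q r) (F.+ᴹ-cong (*-comm q p) (*-comm r p)))

  commutativeRing : CommutativeRing (c ⊔ i) (i ⊔ ℓ)
  commutativeRing = record
    { Carrier = FormalSum
    ; _≈_ = _≈_
    ; _+_ = _++_
    ; _*_ = _*_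
    ; -_  = neg
    ; 0#  = []
    ; 1#  = single R.1# X.ε
    ; isCommutativeRing = record
      { isRing = record
        { +-isAbelianGroup = F.+ᴹ-isAbelianGroup
        ; *-cong = *-cong
        ; *-assoc = *-assoc
        ; *-identity = *-identityˡ , (λ p → ≈-trans (*-comm p (single R.1# X.ε)) (*-identityˡ p))
        ; distrib = *-distribˡ , *-distribʳ
        }
      ; *-comm = *-comm
      }
    }

  constant : R.Carrier → FormalSum
  constant a = single a X.ε

  constant-isRingHomomorphism :
    IsRingHomomorphism R.rawRing (CommutativeRing.rawRing commutativeRing) constant
  constant-isRingHomomorphism = record
    { isSemiringHomomorphism = record
      { isNearSemiringHomomorphism = record
        { +-isMonoidHomomorphism = record
          { isMagmaHomomorphism = record
            { isRelHomomorphism = record { cong = λ a≈b → single-cong a≈b X.refl }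
            ; homo = λ a b → single-+ a b X.ε
            }
          ; ε-homo = single-0 X.ε
          }
        ; *-homo = λ a b → single-cong (R.*-congˡ (R.sym (R.*-identityʳ b)))
                                       (X.sym (X.identityˡ X.ε))
        }
      ; 1#-homo = ≈-refl
      }
    ; -‿homo = λ a → ≈-refl
    }

module _ (R : CommutativeRing c ℓ) (A : CommutativeRing i ℓi)
         {φ : CommutativeRing.Carrier R → CommutativeRing.Carrier A}
         (φ-hom : IsRingHomomorphism (CommutativeRing.rawRing R) (CommutativeRing.rawRing A) φ)
         where
  private
    module R = CommutativeRing R
    module A = CommutativeRing A
    module φ = IsRingHomomorphism φ-hom

  restrictScalars : LeftModule A.ring m ℓm → LeftModule R.ring m ℓm
  restrictScalars M = record
    { Carrierᴹ = M.Carrierᴹ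
    ; _≈ᴹ_ = M._≈ᴹ_
    ; _+ᴹ_ = M._+ᴹ_
    ; _*ₗ_ = λ a u → φ a M.*ₗ u
    ; 0ᴹ   = M.0ᴹ
    ; -ᴹ_  = M.-ᴹ_
    ; isLeftModule = record
      { isLeftSemimodule = record
        { +ᴹ-isCommutativeMonoid = M.+ᴹ-isCommutativeMonoid
        ; isPreleftSemimodule = record
          { *ₗ-cong = λ a≈b u≈w → M.*ₗ-cong (φ.⟦⟧-cong a≈b) u≈w
          ; *ₗ-zeroˡ = λ u → M.≈ᴹ-trans (M.*ₗ-congʳ φ.0#-homo) (M.*ₗ-zeroˡ u)
          ; *ₗ-distribʳ = λ u a b → M.≈ᴹ-trans (M.*ₗ-congʳ (φ.+-homo a b)) (M.*ₗ-distribʳ u _ _)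
          ; *ₗ-identityˡ = λ u → M.≈ᴹ-trans (M.*ₗ-congʳ φ.1#-homo) (M.*ₗ-identityˡ u)
          ; *ₗ-assoc = λ a b u → M.≈ᴹ-trans (M.*ₗ-congʳ (φ.*-homo a b)) (M.*ₗ-assoc _ _ u)
          ; *ₗ-zeroʳ = λ a → M.*ₗ-zeroʳ _
          ; *ₗ-distribˡ = λ a → M.*ₗ-distribˡ _
          }
        }
      ; -ᴹ‿cong = M.-ᴹ‿cong
      ; -ᴹ‿inverse = M.-ᴹ‿inverse
      }
    }
    where module M = LeftModule M

  -- If (vₓ) is an R-basis of A, then (vₓ [j]) is an R-basis of the free A-module on J.

  module _ {b ℓb j ℓj : Level} {I : DecSetoid b ℓb} (J : DecSetoid j ℓj)
           {v : DecSetoid.Carrier I → A.Carrier} where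
    private
      module I  = DecSetoid I
      module J  = DecSetoid J
      module FI = FormalSum R I
      module FJ = FormalSum A J
      module F  = LeftModule FJ.freeModule
      module FIJ = FormalSum R (×-decSetoid I J)
      A-as-R-module = restrictScalars FJ.R-module
      A⟨J⟩ = restrictScalars FJ.freeModule
      lcA  = FI.linearCombination A-as-R-module v

      w : I.Carrier × J.Carrier → FJ.FormalSum
      w (x , y) = FJ.single (v x) y
      lcJ = FIJ.linearCombination A⟨J⟩ w

      tag : J.Carrier → FI.FormalSum → FIJ.FormalSum
      tag y = map (λ (a , x) → (a , (x , y)))

      lc-tag : ∀ y xs → lcJ (tag y xs) FJ.≈ FJ.single (lcA xs) y
      lc-tag y []             = FJ.≈-sym (FJ.single-0 y)
      lc-tag y ((a , x) ∷ xs) = FJ.≈-trans (F.+ᴹ-congˡ {FJ.single (φ a A.* v x) y} (lc-tag y xs))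
                                           (FJ.≈-sym (FJ.single-+ _ _ y))

      slice : J.Carrier → FIJ.FormalSum → FI.FormalSum
      slice y []                    = []
      slice y ((a , (x , y′)) ∷ xs) with y J.≟ y′
      ... | yes _ = (a , x) ∷ slice y xs
      ... | no  _ = slice y xs

      coeff-lc : ∀ y xs → FJ.coeff (lcJ xs) y A.≈ lcA (slice y xs)
      coeff-lc y []                    = A.refl
      coeff-lc y ((a , (x , y′)) ∷ xs) with y J.≟ y′
      ... | yes _ = A.+-cong (A.*-identityʳ _) (coeff-lc y xs)
      ... | no  _ = A.trans (A.+-cong (A.zeroʳ _) (coeff-lc y xs)) (A.+-identityˡ _)

      coeff-slice : ∀ x y xs → FIJ.coeff xs (x , y) R.≈ FI.coeff (slice y xs) x
      coeff-slice x y []                      = R.refl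
      coeff-slice x y ((a , (x′ , y′)) ∷ xs) with y J.≟ y′
      ... | yes _ with x I.≟ x′
      ...   | yes _ = R.+-congˡ (coeff-slice x y xs)
      ...   | no  _ = R.+-congˡ (coeff-slice x y xs)
      coeff-slice x y ((a , (x′ , y′)) ∷ xs) | no _ with x I.≟ x′
      ...   | yes _ = R.trans (R.+-cong (R.zeroʳ a) (coeff-slice x y xs)) (R.+-identityˡ _)
      ...   | no  _ = R.trans (R.+-cong (R.zeroʳ a) (coeff-slice x y xs)) (R.+-identityˡ _)

    free-basis : IsBasis R (restrictScalars FJ.R-module) I v →
                 IsBasis R (restrictScalars FJ.freeModule) (×-decSetoid I J)
                   (λ (x , y) → FJ.single (v x) y)
    free-basis basis = record { spanning = span ; independent = indep }
      where
      open IsBasis basis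
      span : ∀ u → ∃ λ xs → lcJ xs FJ.≈ u
      span []            = [] , FJ.≈-refl
      span ((a , y) ∷ u) with spanning a | span u
      ... | xs , p | ys , q = tag y xs ++ ys ,
        FJ.≈-trans (FIJ.lc-++ A⟨J⟩ w (tag y xs) ys)
          (F.+ᴹ-cong {lcJ (tag y xs)} {FJ.single a y}
            (FJ.≈-trans (lc-tag y xs) (FJ.single-cong p J.refl)) q)

      indep : ∀ xs → lcJ xs FJ.≈ [] → xs FIJ.≈ []
      indep xs z = FIJ.coeffwise λ (x , y) →
        R.trans (coeff-slice x y xs) (FI.coeff≈
          (independent (slice y xs) (A.trans (A.sym (coeff-lc y xs)) (FJ.coeff≈ z y))) x)

-- A list of exponents is read as extended by zeros, so trailing zeros are immaterial.
module Exponents where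

  exponent : List ℕ → ℕ → ℕ
  exponent []       n       = 0
  exponent (e ∷ es) zero    = e
  exponent (e ∷ es) (suc n) = exponent es n

  infix 4 _≈ₑ_
  record _≈ₑ_ (d e : List ℕ) : Set where
    constructor pointwise
    field exponent≡ : ∀ n → exponent d n ≡ exponent e n
  open _≈ₑ_ public

  infixl 6 _+ₑ_
  _+ₑ_ : List ℕ → List ℕ → List ℕ
  []       +ₑ e        = e
  (x ∷ xs) +ₑ []       = x ∷ xs
  (x ∷ xs) +ₑ (y ∷ ys) = x ℕ.+ y ∷ xs +ₑ ys

  exponent-+ₑ : ∀ d e n → exponent (d +ₑ e) n ≡ exponent d n ℕ.+ exponent e n
  exponent-+ₑ []       e        n       = ≡.refl
  exponent-+ₑ (x ∷ xs) []       n       = ≡.sym (ℕₚ.+-identityʳ _)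
  exponent-+ₑ (x ∷ xs) (y ∷ ys) zero    = ≡.refl
  exponent-+ₑ (x ∷ xs) (y ∷ ys) (suc n) = exponent-+ₑ xs ys n

  infix 4 _≟ₑ_
  _≟ₑ_ : Decidable _≈ₑ_
  []       ≟ₑ []       = yes (pointwise λ _ → ≡.refl)
  []       ≟ₑ (y ∷ ys) = map′
    (λ (p , q) → pointwise λ { zero → p ; (suc n) → exponent≡ q n })
    (λ p → exponent≡ p 0 , pointwise (exponent≡ p ∘ suc))
    ((0 ℕₚ.≟ y) ×-dec ([] ≟ₑ ys))
  (x ∷ xs) ≟ₑ []       = map′
    (λ (p , q) → pointwise λ { zero → p ; (suc n) → exponent≡ q n })
    (λ p → exponent≡ p 0 , pointwise (exponent≡ p ∘ suc))
    ((x ℕₚ.≟ 0) ×-dec (xs ≟ₑ []))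
  (x ∷ xs) ≟ₑ (y ∷ ys) = map′
    (λ (p , q) → pointwise λ { zero → p ; (suc n) → exponent≡ q n })
    (λ p → exponent≡ p 0 , pointwise (exponent≡ p ∘ suc))
    ((x ℕₚ.≟ y) ×-dec (xs ≟ₑ ys))

  +ₑ-commutativeMonoid : CommutativeMonoid 0ℓ 0ℓ
  +ₑ-commutativeMonoid = record
    { Carrier = List ℕ
    ; _≈_ = _≈ₑ_
    ; _∙_ = _+ₑ_
    ; ε   = []
    ; isCommutativeMonoid = record
      { isMonoid = record
        { isSemigroup = record
          { isMagma = record
            { isEquivalence = record
              { refl  = pointwise λ _ → ≡.refl
              ; sym   = λ p → pointwise λ n → ≡.sym (exponent≡ p n)
              ; trans = λ p q → pointwise λ n → ≡.trans (exponent≡ p n) (exponent≡ q n)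
              }
            ; ∙-cong = λ {d} {d′} {e} {e′} p q → pointwise λ n →
                ≡.trans (exponent-+ₑ d e n)
                  (≡.trans (≡.cong₂ ℕ._+_ (exponent≡ p n) (exponent≡ q n))
                    (≡.sym (exponent-+ₑ d′ e′ n)))
            }
          ; assoc = λ d e f → pointwise λ n →
              ≡.trans (exponent-+ₑ (d +ₑ e) f n)
                (≡.trans (≡.cong (ℕ._+ exponent f n) (exponent-+ₑ d e n))
                  (≡.trans (ℕₚ.+-assoc (exponent d n) _ _)
                    (≡.sym (≡.trans (exponent-+ₑ d (e +ₑ f) n)
                      (≡.cong (exponent d n ℕ.+_) (exponent-+ₑ e f n))))))
          }
        ; identity = (λ e → pointwise λ _ → ≡.refl) , (λ e → pointwise λ n →
            ≡.trans (exponent-+ₑ e [] n) (ℕₚ.+-identityʳ _))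
        }
      ; comm = λ d e → pointwise λ n →
          ≡.trans (exponent-+ₑ d e n)
            (≡.trans (ℕₚ.+-comm (exponent d n) _) (≡.sym (exponent-+ₑ e d n)))
      }
    }

  weightFrom : ℕ → List ℕ → ℕ
  weightFrom k []       = 0
  weightFrom k (e ∷ es) = k ℕ.* e ℕ.+ weightFrom (suc k) es

  -- The exponent in position n belongs to a variable of degree n + 1.
  weight : List ℕ → ℕ
  weight = weightFrom 1

module Determinant (A : CommutativeRing c ℓ) where
  open CommutativeRing A hiding (zero)
  open Sum +-commutativeMonoid using (sum)
  open Exp semiring using (_^_)

  det : ∀ n → (Fin n → Fin n → Carrier) → Carrier
  det zero    M = 1#
  det (suc n) M = sum λ i →
    (- 1#) ^ toℕ i * M i zero * det n (λ r s → M (punchIn i r) (suc s))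

record Partition : Set where
  field
    parts      : List ℕ
    positive   : All (0 ℕ.<_) parts
    decreasing : Linked ℕ._≥_ parts
open Partition public

Partition-decSetoid : DecSetoid 0ℓ 0ℓ
Partition-decSetoid = On.decSetoid (≡.decSetoid (Listₚ.≡-dec ℕₚ._≟_)) parts

conjugate : List ℕ → List ℕ
conjugate []         = []
conjugate α@(a ∷ _) = applyUpTo (λ j → length (filter (suc j ℕₚ.≤?_) α)) a

-- entry α t is the component α_{t+1}.
entry : List ℤ → ℕ → ℤ
entry []       t       = + 0
entry (a ∷ as) zero    = a
entry (a ∷ as) (suc t) = entry as t

entry-beyond : ∀ α t → length α ℕ.≤ t → entry α t ≡ + 0
entry-beyond []       t       l           = ≡.refl
entry-beyond (a ∷ as) (suc t) (ℕ.s≤s l) = entry-beyond as t l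

-- contract α t = (α₁ + 1, …, α_t + 1, α_{t+2}, α_{t+3}, …)
contract : List ℤ → ℕ → List ℤ
contract []       zero    = []
contract []       (suc t) = + 1 ∷ contract [] t
contract (a ∷ as) zero    = as
contract (a ∷ as) (suc t) = ℤ.suc a ∷ contract as t

-- K plays the role of ℂ; no property of ℂ beyond being a commutative ring is used.
module PolynomialRing (K : CommutativeRing c ℓ) where
  private module K = CommutativeRing K
  open Exponents public

  -- K[h₁⁽⁰⁾, h₂⁽⁰⁾, …]; an exponent vector e stands for ∏ (h⁽⁰⁾_{n+1})^(exponent e n).
  module B where
    open MonoidAlgebra K +ₑ-commutativeMonoid _≟ₑ_ public
    open CommutativeRing commutativeRing public using (Carrier; _+_; -_; 0#; 1#)

  B-ring : CommutativeRing c ℓ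
  B-ring = B.commutativeRing

  B-module : LeftModule K.ring c ℓ
  B-module = restrictScalars K B-ring B.constant-isRingHomomorphism
    (TensorUnit.leftModule {R = CommutativeRing.ring B-ring})

  h⁰ : ℤ → B.Carrier
  h⁰ -[1+ _ ]    = B.0#
  h⁰ (+ zero)    = B.1#
  h⁰ (+ (suc n)) = B.single K.1# (List.replicate n 0 ++ [ 1 ])

  -- The homogeneous components of degree > n vanish.
  infix 4 _∈B≤_
  _∈B≤_ : B.Carrier → ℤ → Set ℓ
  b ∈B≤ n = ∀ e → n ℤ.< + weight e → B.coeff b e K.≈ K.0#

  -- h r k stands for h_k^{(r)}; i and j are counted from 0.
  schurDet : (ℤ → ℤ → B.Carrier) → ℕ → List ℤ → B.Carrier
  schurDet h N α = det N λ i j → h (+ toℕ j) (entry α (toℕ i) ℤ.- + toℕ i)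
    where open Determinant B-ring

  -- For i ≥ length α row i is (0, …, 0, 1, *, …) with the 1 on the diagonal (by
  -- IsSchurFamily below), so N = length α already gives the stable value of the determinant.
  schur : (ℤ → ℤ → B.Carrier) → List ℤ → B.Carrier
  schur h α = schurDet h (length α) α

  record IsSchurFamily (h : ℤ → ℤ → B.Carrier) : Set (c ⊔ ℓ) where
    field
      extends       : ∀ k → h (+ 0) k B.≈ h⁰ k
      degree        : ∀ r k → h r k ∈B≤ (k ℤ.+ r)
      normalised    : ∀ k → h k (ℤ.- k) B.≈ B.1#
      vanishing     : ∀ r k → k ℤ.+ r ℤ.< + 0 → h r k B.≈ B.0#
      schur-isBasis : IsBasis K B-module Partition-decSetoid
                        (λ p → schur h (map +_ (parts p)))

module Fermions (K : CommutativeRing c ℓ) {h : ℤ → ℤ → PolynomialRing.B.Carrier K}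
                (isSchurFamily : PolynomialRing.IsSchurFamily K h) where
  private module K = CommutativeRing K
  open PolynomialRing K
  open IsSchurFamily isSchurFamily
  open Exp K.semiring using (_^_)

  s : List ℤ → B.Carrier
  s = schur h

  -- B[z, z⁻¹] is the algebra of the monoid (ℤ, +) over B.
  module Laurent = MonoidAlgebra B-ring ℤₚ.+-0-commutativeMonoid ℤₚ._≟_

  𝓑 : LeftModule K.ring c ℓ
  𝓑 = restrictScalars K B-ring B.constant-isRingHomomorphism Laurent.freeModule

  open LeftModule 𝓑 public
    using (Carrierᴹ; _≈ᴹ_; _+ᴹ_; 0ᴹ; _*ₗ_)
  open Sum (LeftModule.+ᴹ-commutativeMonoid 𝓑) using (sum)

  infix 8 _z^_
  _z^_ : B.Carrier → ℤ → Carrierᴹ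
  b z^ m = Laurent.single b m

  1𝓑 : Carrierᴹ
  1𝓑 = B.1# z^ (+ 0)

  basis : IsBasis K 𝓑 (×-decSetoid Partition-decSetoid Laurent.decSetoid)
            (λ (p , m) → s (map +_ (parts p)) z^ m)
  basis = free-basis K B-ring B.constant-isRingHomomorphism Laurent.decSetoid schur-isBasis

  δ : ℤ → ℤ → K.Carrier
  δ k l = if does (k ℤₚ.≟ l) then K.1# else K.0#

  sign : ℕ → K.Carrier
  sign n = (K.- K.1#) ^ n

  -- Sum of an infinite sequence whose terms vanish from position N on.
  ∑∞ : (a : ℕ → Carrierᴹ) (N : ℕ) → (∀ t → N ℕ.≤ t → a t ≈ᴹ 0ᴹ) → Carrierᴹ
  ∑∞ a N _ = sum {N} (a ∘ toℕ)

  ψ-value : ℤ → List ℤ → ℤ → Carrierᴹ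
  ψ-value k α m = s (k ℤ.- m ℤ.- + 1 ∷ α) z^ (m ℤ.+ + 1)

  ψ : ℤ → Carrierᴹ → Carrierᴹ
  ψ k = linearExtension basis 𝓑 λ (p , m) → ψ-value k (map +_ (parts p)) m

  -- With t counted from 0, so that the term with index t here is the (t+1)-st one.
  ψ*-term : ℤ → List ℤ → ℤ → ℕ → Carrierᴹ
  ψ*-term k α m t =
    (sign t K.* δ (k ℤ.- m ℤ.- + 1) (entry α t ℤ.- + suc t))
      *ₗ s (contract α t) z^ (m ℤ.- + 1)

  ψ*-bound : ℤ → List ℤ → ℤ → ℕ
  ψ*-bound k α m = length α ℕ.+ ℤ.∣ k ℤ.- m ℤ.- + 1 ∣

  ψ*-term-vanishes : ∀ k α m t → ψ*-bound k α m ℕ.≤ t → ψ*-term k α m t ≈ᴹ 0ᴹ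
  ψ*-term-vanishes k α m t l = ≈ᴹ-trans
    (*ₗ-congʳ {u} (K.trans (K.*-congˡ δ≈0) (K.zeroʳ (sign t))))
    (*ₗ-zeroˡ u)
    where
    open LeftModule 𝓑 using (≈ᴹ-trans; *ₗ-congʳ; *ₗ-zeroˡ)
    u = s (contract α t) z^ (m ℤ.- + 1)
    d = k ℤ.- m ℤ.- + 1

    entry≡0 : entry α t ≡ + 0
    entry≡0 = entry-beyond α t (ℕₚ.≤-trans (ℕₚ.m≤m+n (length α) ℤ.∣ d ∣) l)

    d≢ : ¬ d ≡ entry α t ℤ.- + suc t
    d≢ eq = ℕₚ.<-irrefl
      (≡.cong ℤ.∣_∣ (≡.trans eq (≡.cong (ℤ._- + suc t) entry≡0)))
      (ℕ.s≤s (ℕₚ.≤-trans (ℕₚ.m≤n+m ℤ.∣ d ∣ (length α)) l))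

    δ≈0 : δ d (entry α t ℤ.- + suc t) K.≈ K.0#
    δ≈0 with d ℤₚ.≟ (entry α t ℤ.- + suc t)
    ... | yes eq = ⊥-elim (d≢ eq)
    ... | no  _  = K.refl

  ψ*-value : ℤ → List ℤ → ℤ → Carrierᴹ
  ψ*-value k α m = ∑∞ (ψ*-term k α m) (ψ*-bound k α m) (ψ*-term-vanishes k α m)

  ψ* : ℤ → Carrierᴹ → Carrierᴹ
  ψ* k = linearExtension basis 𝓑 λ (p , m) → ψ*-value k (map +_ (parts p)) m

  private
    parts-cong : (g : List ℤ → ℤ → Carrierᴹ) {p q : Partition} {m n : ℤ} →
                 parts p ≡ parts q → m ≡ n →
                 g (map +_ (parts p)) m ≈ᴹ g (map +_ (parts q)) n
    parts-cong g p≡q m≡n =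
      LeftModule.≈ᴹ-reflexive 𝓑 (≡.cong₂ (λ ps → g (map +_ ps)) p≡q m≡n)

  ψ-basis : ∀ k p m →
            ψ k (s (map +_ (parts p)) z^ m) ≈ᴹ ψ-value k (map +_ (parts p)) m
  ψ-basis k p m = linearExtension-basis basis 𝓑
    (λ (p , m) → ψ-value k (map +_ (parts p)) m)
    (λ {x} {y} (p≡q , m≡n) → parts-cong (ψ-value k) {proj₁ x} {proj₁ y} p≡q m≡n) (p , m)

  ψ*-basis : ∀ k p m →
             ψ* k (s (map +_ (parts p)) z^ m) ≈ᴹ ψ*-value k (map +_ (parts p)) m
  ψ*-basis k p m = linearExtension-basis basis 𝓑
    (λ (p , m) → ψ*-value k (map +_ (parts p)) m)
    (λ {x} {y} (p≡q , m≡n) → parts-cong (ψ*-value k) {proj₁ x} {proj₁ y} p≡q m≡n) (p , m)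

  -- (λ₁ + l, λ₂ + l - 1, …, λ_l + 1)
  creation-indices : List ℕ → List ℤ
  creation-indices []       = []
  creation-indices (a ∷ as) = + a ℤ.+ + suc (length as) ∷ creation-indices as

  -- (- λ₁ - l + 1, …, - λ_{l-1} - 1, - λ_l)
  annihilation-indices : List ℕ → List ℤ
  annihilation-indices []       = []
  annihilation-indices (a ∷ as) = ℤ.- + a ℤ.- + length as ∷ annihilation-indices as

{-# OPTIONS --safe #-}

-- Call a function F of integer vectors straightenable if it changes sign under
-- (a, b) ↦ (b - 1, a + 1), vanishes at (a, a + 1), and ignores trailing zeros.  Such an F is
-- determined by its values on partitions.  The determinant s_α is straightenable, and so are
-- the right-hand sides of the formulas for ψ and ψ*; hence these formulas hold on s_α z^m for
-- every integer vector α.  Then {ψ_k, ψ_l} = 0 is one exchange, and {ψ_k, ψ*_l} = δ is the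
-- splitting of the sum for ψ*_l into its first term and the rest.  Consequently {ψ*_k, ψ*_l}
-- commutes with every ψ_j; it kills z^m for small m, and the ψ_j generate all s_α z^m from there.
module Submission where

open import Defs
open import Algebra.Bundles using (CommutativeRing; CommutativeMonoid)
open import Algebra.Module.Bundles using (LeftModule)
import Algebra.Module.Construct.TensorUnit as TensorUnit
open import Algebra.Module.Morphism.Structures using (module LeftModuleMorphisms)
import Algebra.Properties.AbelianGroup as AbelianGroupProperties
import Algebra.Properties.CommutativeMonoid.Sum as Sum
import Algebra.Properties.CommutativeSemigroup as CommutativeSemigroupProperties
import Algebra.Properties.Semiring.Exp as Exp
open import Data.Bool.Base using (if_then_else_)
open import Data.Empty using (⊥-elim)
open import Data.Fin.Base using (Fin; zero; suc; toℕ; punchIn)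
import Data.Fin.Properties as Finₚ
open import Data.Integer.Base as ℤ using (ℤ; +_; -[1+_]; -_)
import Data.Integer.Properties as ℤₚ
open import Data.Integer.Tactic.RingSolver using (solve-∀)
open import Data.List.Base
  using (List; []; _∷_; _++_; map; foldr; length; sum; filter; applyUpTo)
import Data.List.Properties as Listₚ
open import Data.List.Relation.Unary.All as All using (All; []; _∷_)
open import Data.List.Relation.Unary.Linked as Linked using (Linked; []; [-]; _∷_)
open import Data.List.Relation.Unary.Linked.Properties using (Linked⇒All)
open import Data.Nat.Base as ℕ using (ℕ; zero; suc; _≥_; s≤s; z≤n; z<s; s<s)
import Data.Nat.Properties as ℕₚ
open import Data.Product.Base using (_×_; _,_; proj₁; ∃)
open import Data.Product.Relation.Binary.Pointwise.NonDependent using (×-decSetoid)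
open import Function.Base using (_∘_)
open import Level using (Level; _⊔_)
open import Relation.Binary.Bundles using (DecSetoid)
open import Relation.Binary.Definitions using (tri<; tri≈; tri>)
open import Relation.Binary.PropositionalEquality as ≡ using (_≡_; _≢_)
import Relation.Binary.Reasoning.Setoid as SetoidReasoning
open import Relation.Nullary using (yes; no; does)

-- The obstacle is that `ψ` and `ψ*` are prescribed only on partitions, whereas a single application
-- already produces other vectors. No product of two operators can be read off before both formulas
-- are known at every integer vector. Expanding a determinant along its first column and summing
-- over the rows that `ψ*` may delete are the same operation, `contraction`, with different weights;
-- one induction therefore yields both alternations. As 2 need not be invertible in `K`, vanishing
-- at equal rows does not follow from the change of sign and is carried along as a second condition.
-- A determinant of size N sees N entries and a contraction has N terms, so alternation comes with a
-- bound on the length; the bound disappears because the values do not depend on N once N is large.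
-- For the relation between two `ψ*`, the detour through the ψ_j replaces a double sum over two
-- deleted rows together with its signs.

private variable
  c ℓ m ℓm c′ ℓ′ m′ ℓm′ i ℓi : Level

i≤∣i∣ : ∀ i → i ℤ.≤ + ℤ.∣ i ∣
i≤∣i∣ (+ n)    = ℤₚ.≤-refl
i≤∣i∣ -[1+ n ] = ℤ.-≤+

length-contract : ∀ α {N} t → length α ℕ.≤ N → t ℕ.< N → length (contract α t) ℕ.< N
length-contract []      zero    _       t<N       = t<N
length-contract []      (suc t) _       (s<s t<N) = s<s (length-contract [] t z≤n t<N)
length-contract (a ∷ α) zero    α<N     _         = α<N
length-contract (a ∷ α) (suc t) (s≤s l) (s<s t<N) = s<s (length-contract α t l t<N)

entry-++0 : ∀ α t → entry (α ++ + 0 ∷ []) t ≡ entry α t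
entry-++0 []      zero    = ≡.refl
entry-++0 []      (suc t) = ≡.refl
entry-++0 (a ∷ α) zero    = ≡.refl
entry-++0 (a ∷ α) (suc t) = entry-++0 α t

-- Alternating functions of integer vectors and their contractions.

module Straightening (R : CommutativeRing c ℓ)
                     (M : LeftModule (CommutativeRing.ring R) m ℓm) where
  private module R = CommutativeRing R
  open LeftModule M
  open AbelianGroupProperties +ᴹ-abelianGroup
    using (inverseˡ-unique; ⁻¹-∙-comm; ε⁻¹≈ε)
  open CommutativeSemigroupProperties
    (CommutativeMonoid.commutativeSemigroup +ᴹ-commutativeMonoid)
    using (interchange)
  open SetoidReasoning ≈ᴹ-setoid
  open Exp R.semiring using (_^_)
  private module S = Sum +ᴹ-commutativeMonoid

  infixl 6 _-ᴹ_
  _-ᴹ_ : Carrierᴹ → Carrierᴹ → Carrierᴹ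
  x -ᴹ y = x +ᴹ -ᴹ y

  private
    -ᴹ-interchange : ∀ a b c d → (a -ᴹ b) +ᴹ (c -ᴹ d) ≈ᴹ (a +ᴹ c) -ᴹ (b +ᴹ d)
    -ᴹ-interchange a b c d =
      ≈ᴹ-trans (interchange a (-ᴹ b) c (-ᴹ d)) (+ᴹ-congˡ (⁻¹-∙-comm b d))

    x-y≈0 : ∀ {x y} → x ≈ᴹ 0ᴹ → y ≈ᴹ 0ᴹ → x -ᴹ y ≈ᴹ 0ᴹ
    x-y≈0 {x} {y} p q = ≈ᴹ-trans (+ᴹ-cong p (≈ᴹ-trans (-ᴹ‿cong q) ε⁻¹≈ε)) (+ᴹ-identityˡ 0ᴹ)

    x+y≈0 : ∀ {x y} → x ≈ᴹ 0ᴹ → y ≈ᴹ 0ᴹ → x +ᴹ y ≈ᴹ 0ᴹ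
    x+y≈0 p q = ≈ᴹ-trans (+ᴹ-cong p q) (+ᴹ-identityˡ 0ᴹ)

  -- The shape of two successive expansions: the terms `x` and `y` of one order return in the other
  -- with their roles exchanged. It serves for two adjacent rows and later for two operators `ψ*`
  -- moved past one `ψ`.
  cancel : ∀ {x y x′ y′ p q} → x ≈ᴹ x′ → y ≈ᴹ y′ → p +ᴹ q ≈ᴹ 0ᴹ →
           (x -ᴹ (y -ᴹ p)) +ᴹ (y′ -ᴹ (x′ -ᴹ q)) ≈ᴹ 0ᴹ
  cancel {x} {y} {x′} {y′} {p} {q} x≈x′ y≈y′ p+q = begin
    (x -ᴹ (y -ᴹ p)) +ᴹ (y′ -ᴹ (x′ -ᴹ q))
      ≈⟨ +ᴹ-congˡ (+ᴹ-cong y≈y′ (-ᴹ‿cong (+ᴹ-congʳ x≈x′))) ⟨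
    (x -ᴹ (y -ᴹ p)) +ᴹ (y -ᴹ (x -ᴹ q))
      ≈⟨ -ᴹ-interchange x (y -ᴹ p) y (x -ᴹ q) ⟩
    (x +ᴹ y) -ᴹ ((y -ᴹ p) +ᴹ (x -ᴹ q))
      ≈⟨ +ᴹ-congˡ (-ᴹ‿cong (-ᴹ-interchange y p x q)) ⟩
    (x +ᴹ y) -ᴹ ((y +ᴹ x) -ᴹ (p +ᴹ q))
      ≈⟨ +ᴹ-congˡ (-ᴹ‿cong (+ᴹ-cong (+ᴹ-comm y x) (≈ᴹ-trans (-ᴹ‿cong p+q) ε⁻¹≈ε))) ⟩
    (x +ᴹ y) -ᴹ ((x +ᴹ y) +ᴹ 0ᴹ)
      ≈⟨ +ᴹ-congˡ (-ᴹ‿cong (+ᴹ-identityʳ (x +ᴹ y))) ⟩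
    (x +ᴹ y) -ᴹ (x +ᴹ y)
      ≈⟨ -ᴹ‿inverseʳ (x +ᴹ y) ⟩
    0ᴹ ∎

  -- In terms of the rows αᵢ - i: exchanging two adjacent rows changes the sign of F,
  -- and F vanishes when they are equal.
  record AlternatingBelow (N : ℕ) (F : List ℤ → Carrierᴹ) : Set ℓm where
    field
      swap   : ∀ β a b γ → length (β ++ a ∷ b ∷ γ) ℕ.< N →
               F (β ++ a ∷ ℤ.suc b ∷ γ) +ᴹ F (β ++ b ∷ ℤ.suc a ∷ γ) ≈ᴹ 0ᴹ
      repeat : ∀ β a γ → length (β ++ a ∷ a ∷ γ) ℕ.< N →
               F (β ++ a ∷ ℤ.suc a ∷ γ) ≈ᴹ 0ᴹ
  open AlternatingBelow

  alternating-∷ : ∀ {N F} → AlternatingBelow (suc N) F → ∀ a → AlternatingBelow N (F ∘ (a ∷_))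
  alternating-∷ F-alt a .swap β b c γ l = F-alt .swap (a ∷ β) b c γ (s<s l)
  alternating-∷ F-alt a .repeat β b γ l = F-alt .repeat (a ∷ β) b γ (s<s l)

  -- With w k = h⁽⁰⁾_k this is the expansion of the determinant s_α along its first column;
  -- with w = δ it is the sum defining ψ*.
  contraction-term : (ℤ → R.Carrier) → (List ℤ → Carrierᴹ) → List ℤ → ℕ → Carrierᴹ
  contraction-term w F α t = ((R.- R.1#) ^ t R.* w (entry α t ℤ.- + t)) *ₗ F (contract α t)

  contraction : ℕ → (ℤ → R.Carrier) → (List ℤ → Carrierᴹ) → List ℤ → Carrierᴹ
  contraction N w F α = S.sum {N} (contraction-term w F α ∘ toℕ)

  sum-cong< : ∀ N {f g : ℕ → Carrierᴹ} → (∀ t → t ℕ.< N → f t ≈ᴹ g t) →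
              S.sum {N} (f ∘ toℕ) ≈ᴹ S.sum {N} (g ∘ toℕ)
  sum-cong< N f≈g = S.sum-cong-≋ {N} (λ i → f≈g (toℕ i) (Finₚ.toℕ<n i))

  sum-zero : ∀ N {f : ℕ → Carrierᴹ} → (∀ t → t ℕ.< N → f t ≈ᴹ 0ᴹ) → S.sum {N} (f ∘ toℕ) ≈ᴹ 0ᴹ
  sum-zero zero    f≈0 = ≈ᴹ-refl
  sum-zero (suc N) f≈0 = x+y≈0 (f≈0 0 z<s) (sum-zero N (λ t t<N → f≈0 (suc t) (s<s t<N)))

  sum-neg : ∀ N (f : ℕ → Carrierᴹ) → S.sum {N} ((-ᴹ_ ∘ f) ∘ toℕ) ≈ᴹ -ᴹ S.sum {N} (f ∘ toℕ)
  sum-neg zero    f = ≈ᴹ-sym ε⁻¹≈ε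
  sum-neg (suc N) f = ≈ᴹ-trans (+ᴹ-congˡ (sum-neg N (f ∘ suc))) (⁻¹-∙-comm _ _)

  sum-snoc : ∀ N (f : ℕ → Carrierᴹ) →
             S.sum {suc N} (f ∘ toℕ) ≈ᴹ S.sum {N} (f ∘ toℕ) +ᴹ f N
  sum-snoc zero    f = +ᴹ-comm _ _
  sum-snoc (suc N) f = ≈ᴹ-trans (+ᴹ-congˡ (sum-snoc N (f ∘ suc))) (≈ᴹ-sym (+ᴹ-assoc _ _ _))

  -1*ₗ : ∀ x → (R.- R.1#) *ₗ x ≈ᴹ -ᴹ x
  -1*ₗ x = inverseˡ-unique _ _ (begin
    (R.- R.1#) *ₗ x +ᴹ x           ≈⟨ +ᴹ-congˡ (*ₗ-identityˡ x) ⟨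
    (R.- R.1#) *ₗ x +ᴹ R.1# *ₗ x   ≈⟨ *ₗ-distribʳ x _ _ ⟨
    (R.- R.1# R.+ R.1#) *ₗ x       ≈⟨ *ₗ-congʳ (R.-‿inverseˡ R.1#) ⟩
    R.0# *ₗ x                      ≈⟨ *ₗ-zeroˡ x ⟩
    0ᴹ                             ∎)

  -- Term t = 0 deletes `a`; all others keep it, raised to `suc a`. Counting the remaining rows from
  -- 0 again costs a sign and one unit in the argument of the weight. The mixed relation between `ψ`
  -- and `ψ*` later rests on this split.
  contraction-∷ : ∀ N w F a α → contraction (suc N) w F (a ∷ α) ≈ᴹ
                  w a *ₗ F α -ᴹ contraction N (w ∘ ℤ.pred) (F ∘ (ℤ.suc a ∷_)) α
  contraction-∷ N w F a α = +ᴹ-cong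
    (*ₗ-congʳ (R.trans (R.*-identityˡ _) (R.reflexive (≡.cong w (ℤₚ.+-identityʳ a)))))
    (≈ᴹ-trans (sum-cong< N {f = λ t → contraction-term w F (a ∷ α) (suc t)} (λ t _ → term t))
              (sum-neg N (contraction-term (w ∘ ℤ.pred) (F ∘ (ℤ.suc a ∷_)) α)))
    where
    term : ∀ t → contraction-term w F (a ∷ α) (suc t) ≈ᴹ
                 -ᴹ contraction-term (w ∘ ℤ.pred) (F ∘ (ℤ.suc a ∷_)) α t
    term t = begin
      ((R.- R.1#) R.* (R.- R.1#) ^ t R.* w (entry α t ℤ.- + suc t)) *ₗ x
        ≈⟨ *ₗ-congʳ (R.trans
             (R.*-congˡ (R.reflexive (≡.cong w (ℤₚ.minus-suc (entry α t) t)))) (R.*-assoc _ _ _)) ⟩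
      ((R.- R.1#) R.* ((R.- R.1#) ^ t R.* w (ℤ.pred (entry α t ℤ.- + t)))) *ₗ x
        ≈⟨ *ₗ-assoc _ _ x ⟩
      (R.- R.1#) *ₗ (((R.- R.1#) ^ t R.* w (ℤ.pred (entry α t ℤ.- + t))) *ₗ x)
        ≈⟨ -1*ₗ _ ⟩
      -ᴹ (((R.- R.1#) ^ t R.* w (ℤ.pred (entry α t ℤ.- + t))) *ₗ x) ∎
      where x = F (ℤ.suc a ∷ contract α t)

  contraction-zero : ∀ {N} w F α → length α ℕ.≤ N → (∀ β → length β ℕ.< N → F β ≈ᴹ 0ᴹ) →
                     contraction N w F α ≈ᴹ 0ᴹ
  contraction-zero {N} w F α l F≈0 = sum-zero N {contraction-term w F α} λ t t<N →
    ≈ᴹ-trans (*ₗ-congˡ (F≈0 _ (length-contract α t l t<N))) (*ₗ-zeroʳ _)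

  contraction-+ : ∀ N w F G α →
    contraction N w F α +ᴹ contraction N w G α ≈ᴹ contraction N w (λ β → F β +ᴹ G β) α
  contraction-+ N w F G α = ≈ᴹ-trans
    (≈ᴹ-sym (S.∑-distrib-+ {N} (contraction-term w F α ∘ toℕ) (contraction-term w G α ∘ toℕ)))
    (≈ᴹ-sym (sum-cong< N {contraction-term w (λ β → F β +ᴹ G β) α}
      {λ t → contraction-term w F α t +ᴹ contraction-term w G α t} (λ t _ → *ₗ-distribˡ _ _ _)))

  -- Induction on the prefix. At the head, two expansions are made: the contributions deleting one
  -- of the two rows cancel, those keeping both vanish by the hypothesis on `F`. Behind an entry
  -- `x`, the first term uses `F` and the rest the induction. The bound grows by one because
  -- contracting a vector of length at most `N` gives one of length below `N`.
  contraction-alternating : ∀ {N} w F → AlternatingBelow N F →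
                            AlternatingBelow (suc N) (contraction N w F)
  contraction-alternating {suc (suc N)} w F F-alt .swap [] a b γ (s≤s (s≤s (s≤s l))) =
    ≈ᴹ-trans (+ᴹ-cong (expand a b) (expand b a))
      (cancel (*ₗ-congʳ (w-suc a)) (*ₗ-congʳ (R.sym (w-suc b)))
        (≈ᴹ-trans (contraction-+ N w″ (G a b) (G b a) γ)
          (contraction-zero w″ (λ β → G a b β +ᴹ G b a β) γ l λ β β<N →
            F-alt .swap [] (ℤ.suc a) (ℤ.suc b) β (s<s (s<s β<N)))))
    where
    w″ = w ∘ ℤ.pred ∘ ℤ.pred
    G : ℤ → ℤ → List ℤ → Carrierᴹ
    G a b β = F (ℤ.suc a ∷ ℤ.suc (ℤ.suc b) ∷ β)

    w-suc : ∀ a → w a R.≈ w (ℤ.pred (ℤ.suc a))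
    w-suc a = R.reflexive (≡.cong w (≡.sym (ℤₚ.pred-suc a)))

    expand : ∀ a b → contraction (suc (suc N)) w F (a ∷ ℤ.suc b ∷ γ) ≈ᴹ
      w a *ₗ F (ℤ.suc b ∷ γ) -ᴹ (w (ℤ.pred (ℤ.suc b)) *ₗ F (ℤ.suc a ∷ γ) -ᴹ
        contraction N w″ (G a b) γ)
    expand a b = ≈ᴹ-trans (contraction-∷ (suc N) w F a (ℤ.suc b ∷ γ))
      (+ᴹ-congˡ (-ᴹ‿cong (contraction-∷ N (w ∘ ℤ.pred) (F ∘ (ℤ.suc a ∷_)) (ℤ.suc b) γ)))
  contraction-alternating {suc N} w F F-alt .swap (x ∷ β) a b γ (s≤s (s≤s l)) =
    ≈ᴹ-trans (+ᴹ-cong (contraction-∷ N w F x _) (contraction-∷ N w F x _))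
      (≈ᴹ-trans (-ᴹ-interchange _ _ _ _)
        (x-y≈0 (≈ᴹ-trans (≈ᴹ-sym (*ₗ-distribˡ _ _ _))
               (≈ᴹ-trans (*ₗ-congˡ (F-alt .swap β a b γ (s≤s l))) (*ₗ-zeroʳ _)))
             (contraction-alternating (w ∘ ℤ.pred) _ (alternating-∷ F-alt (ℤ.suc x))
               .swap β a b γ (s≤s l))))
  contraction-alternating {suc (suc N)} w F F-alt .repeat [] a γ (s≤s (s≤s (s≤s l))) = begin
    contraction (suc (suc N)) w F (a ∷ ℤ.suc a ∷ γ)
      ≈⟨ contraction-∷ (suc N) w F a (ℤ.suc a ∷ γ) ⟩
    w a *ₗ u -ᴹ contraction (suc N) (w ∘ ℤ.pred) (F ∘ (ℤ.suc a ∷_)) (ℤ.suc a ∷ γ)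
      ≈⟨ +ᴹ-congˡ (-ᴹ‿cong (contraction-∷ N (w ∘ ℤ.pred) (F ∘ (ℤ.suc a ∷_)) (ℤ.suc a) γ)) ⟩
    w a *ₗ u -ᴹ (w (ℤ.pred (ℤ.suc a)) *ₗ u -ᴹ contraction N w″ G γ)
      ≈⟨ +ᴹ-congˡ (-ᴹ‿cong (+ᴹ-cong
           (*ₗ-congʳ (R.reflexive (≡.cong w (ℤₚ.pred-suc a))))
           (≈ᴹ-trans (-ᴹ‿cong (contraction-zero w″ G γ l λ β β<N →
             F-alt .repeat [] (ℤ.suc a) β (s<s (s<s β<N)))) ε⁻¹≈ε))) ⟩
    w a *ₗ u -ᴹ (w a *ₗ u +ᴹ 0ᴹ)
      ≈⟨ +ᴹ-congˡ (-ᴹ‿cong (+ᴹ-identityʳ _)) ⟩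
    w a *ₗ u -ᴹ w a *ₗ u
      ≈⟨ -ᴹ‿inverseʳ _ ⟩
    0ᴹ ∎
    where
    u = F (ℤ.suc a ∷ γ)
    w″ = w ∘ ℤ.pred ∘ ℤ.pred
    G : List ℤ → Carrierᴹ
    G β = F (ℤ.suc a ∷ ℤ.suc (ℤ.suc a) ∷ β)
  contraction-alternating {suc N} w F F-alt .repeat (x ∷ β) a γ (s≤s (s≤s l)) =
    ≈ᴹ-trans (contraction-∷ N w F x _)
      (x-y≈0 (≈ᴹ-trans (*ₗ-congˡ (F-alt .repeat β a γ (s≤s l))) (*ₗ-zeroʳ _))
           (contraction-alternating (w ∘ ℤ.pred) _ (alternating-∷ F-alt (ℤ.suc x))
             .repeat β a γ (s≤s l)))

  contraction-last : ∀ N w F α → w (entry α N ℤ.- + N) R.≈ R.0# →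
                     contraction (suc N) w F α ≈ᴹ contraction N w F α
  contraction-last N w F α w≈0 = ≈ᴹ-trans (sum-snoc N (contraction-term w F α))
    (≈ᴹ-trans (+ᴹ-congˡ (≈ᴹ-trans (*ₗ-congʳ (R.trans (R.*-congˡ w≈0) (R.zeroʳ _))) (*ₗ-zeroˡ _)))
              (+ᴹ-identityʳ _))

  contraction-single : ∀ N w F α t₀ → t₀ ℕ.< N → w (entry α t₀ ℤ.- + t₀) R.≈ R.1# →
    (∀ t → t ≢ t₀ → w (entry α t ℤ.- + t) R.≈ R.0#) →
    contraction N w F α ≈ᴹ (R.- R.1#) ^ t₀ *ₗ F (contract α t₀)
  contraction-single N w F α t₀ t₀<N w≈1 w≈0 = ≈ᴹ-trans
    (sum-single N (contraction-term w F α) t₀ t₀<N λ t t≢t₀ →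
      ≈ᴹ-trans (*ₗ-congʳ (R.trans (R.*-congˡ (w≈0 t t≢t₀)) (R.zeroʳ _))) (*ₗ-zeroˡ _))
    (*ₗ-congʳ (R.trans (R.*-congˡ w≈1) (R.*-identityʳ _)))
    where
    sum-single : ∀ N (f : ℕ → Carrierᴹ) t₀ → t₀ ℕ.< N → (∀ t → t ≢ t₀ → f t ≈ᴹ 0ᴹ) →
                 S.sum {N} (f ∘ toℕ) ≈ᴹ f t₀
    sum-single (suc N) f zero     _           f≈0 = ≈ᴹ-trans
      (+ᴹ-congˡ (sum-zero N {f ∘ suc} λ t _ → f≈0 (suc t) λ ())) (+ᴹ-identityʳ _)
    sum-single (suc N) f (suc t₀) (s<s t₀<N) f≈0 = ≈ᴹ-trans
      (+ᴹ-cong (f≈0 0 λ ()) (sum-single N (f ∘ suc) t₀ t₀<N λ t t≢t₀ →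
        f≈0 (suc t) (t≢t₀ ∘ ℕₚ.suc-injective)))
      (+ᴹ-identityˡ _)

  ZeroPadded : (List ℤ → Carrierᴹ) → Set ℓm
  ZeroPadded F = ∀ α → F (α ++ + 0 ∷ []) ≈ᴹ F α

  contract-++0 : ∀ F → ZeroPadded F → ∀ α t → F (contract (α ++ + 0 ∷ []) t) ≈ᴹ F (contract α t)
  contract-++0 F F-pad []      zero    = ≈ᴹ-refl
  contract-++0 F F-pad []      (suc t) = ≈ᴹ-refl
  contract-++0 F F-pad (a ∷ α) zero    = F-pad α
  contract-++0 F F-pad (a ∷ α) (suc t) =
    contract-++0 (F ∘ (ℤ.suc a ∷_)) (F-pad ∘ (ℤ.suc a ∷_)) α t

  contraction-padded : ∀ N w F → ZeroPadded F → ZeroPadded (contraction N w F)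
  contraction-padded N w F F-pad α = sum-cong< N
    {contraction-term w F (α ++ + 0 ∷ [])} {contraction-term w F α} λ t _ →
      *ₗ-cong (R.*-congˡ (R.reflexive (≡.cong (λ e → w (e ℤ.- + t)) (entry-++0 α t))))
              (contract-++0 F F-pad α t)

  -- Reduction of straightenable functions to partitions.

  record Straightenable (F : List ℤ → Carrierᴹ) : Set ℓm where
    field
      alternating : ∀ N → AlternatingBelow N F
      padded      : ZeroPadded F

    swap-head : ∀ a b γ → F (a ∷ ℤ.suc b ∷ γ) ≈ᴹ -ᴹ F (b ∷ ℤ.suc a ∷ γ)
    swap-head a b γ = inverseˡ-unique _ _ (alternating _ .swap [] a b γ ℕₚ.≤-refl)

    repeat-head : ∀ a γ → F (a ∷ ℤ.suc a ∷ γ) ≈ᴹ 0ᴹ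
    repeat-head a γ = alternating _ .repeat [] a γ ℕₚ.≤-refl
  open Straightenable public

  straightenable-∷ : ∀ {F} → Straightenable F → ∀ a → Straightenable (F ∘ (a ∷_))
  straightenable-∷ F-str a .alternating N = alternating-∷ (F-str .alternating (suc N)) a
  straightenable-∷ F-str a .padded β      = F-str .padded (a ∷ β)

  straightenable-difference : ∀ {F G} → Straightenable F → Straightenable G →
                     Straightenable (λ α → F α -ᴹ G α)
  straightenable-difference F-str G-str .alternating N .swap β a b γ l =
    ≈ᴹ-trans (-ᴹ-interchange _ _ _ _)
      (x-y≈0 (F-str .alternating N .swap β a b γ l) (G-str .alternating N .swap β a b γ l))
  straightenable-difference F-str G-str .alternating N .repeat β a γ l =
    x-y≈0 (F-str .alternating N .repeat β a γ l) (G-str .alternating N .repeat β a γ l)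
  straightenable-difference F-str G-str .padded α =
    +ᴹ-cong (F-str .padded α) (-ᴹ‿cong (G-str .padded α))

  private
    -≈0 : ∀ {x y} → x ≈ᴹ -ᴹ y → y ≈ᴹ 0ᴹ → x ≈ᴹ 0ᴹ
    -≈0 p q = ≈ᴹ-trans p (≈ᴹ-trans (-ᴹ‿cong q) ε⁻¹≈ε)

  -- Padding by 0 supplies a second row: (-1, 0) is a repetition, and (-n-2, 0) is exchanged into
  -- (-1, -n-1), where the induction applies behind the entry -1.
  vanishes-negative : ∀ {F} → Straightenable F → ∀ n → F (-[1+ n ] ∷ []) ≈ᴹ 0ᴹ
  vanishes-negative {F} F-str zero = begin
    F (-[1+ 0 ] ∷ [])          ≈⟨ F-str .padded _ ⟨
    F (-[1+ 0 ] ∷ + 0 ∷ [])    ≈⟨ repeat-head F-str -[1+ 0 ] [] ⟩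
    0ᴹ                         ∎
  vanishes-negative {F} F-str (suc n) = -≈0
    (≈ᴹ-trans (≈ᴹ-sym (F-str .padded _)) (swap-head F-str -[1+ suc n ] -[1+ 0 ] []))
    (vanishes-negative (straightenable-∷ F-str -[1+ 0 ]) n)

  -- After an exchange `b` stands in front and `suc a` is to be inserted into parts that are at most
  -- `suc b`. This is the same situation with `b` for `n`, which is why the parts may exceed the
  -- bound on `a` by one.
  vanishes-insert : ∀ {F} → Straightenable F → ∀ n →
    (∀ β → All (0 ℕ.<_) β → Linked _≥_ (n ∷ β) → F (map +_ β) ≈ᴹ 0ᴹ) →
    ∀ a β → a ℤ.≤ + n → All (0 ℕ.<_) β → Linked _≥_ (suc n ∷ β) → F (a ∷ map +_ β) ≈ᴹ 0ᴹ
  vanishes-insert F-str n F≈0 (+ zero)  [] a≤n _ _ = ≈ᴹ-trans (F-str .padded []) (F≈0 [] [] [-])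
  vanishes-insert F-str n F≈0 (+ suc a) [] (ℤ.+≤+ a≤n) _ _ = F≈0 (suc a ∷ []) (z<s ∷ []) (a≤n ∷ [-])
  vanishes-insert F-str n F≈0 -[1+ a ]  [] _ _ _ = vanishes-negative F-str a
  vanishes-insert {F} F-str n F≈0 a (suc b ∷ β) a≤n (_ ∷ β>0) (s≤s b≤n ∷ β↓) with ℤₚ.<-cmp a (+ b)
  ... | tri≈ _ ≡.refl _ = repeat-head F-str (+ b) (map +_ β)
  vanishes-insert F-str n F≈0 (+ a) (suc b ∷ β) (ℤ.+≤+ a≤n) β>0 (s≤s b≤n ∷ β↓) | tri> _ _ (ℤ.+<+ b<a) =
    F≈0 (a ∷ suc b ∷ β) (ℕₚ.≤-trans z<s b<a ∷ β>0) (a≤n ∷ b<a ∷ β↓)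
  vanishes-insert {F} F-str n F≈0 a (suc b ∷ β) a≤n (_ ∷ β>0) (s≤s b≤n ∷ β↓) | tri< a<b _ _ =
    -≈0 (swap-head F-str a (+ b) (map +_ β))
        (vanishes-insert (straightenable-∷ F-str (+ b)) b (tail≈0 b b≤n)
          (ℤ.suc a) β (ℤₚ.i<j⇒suc[i]≤j a<b) β>0 β↓)
    where
    tail≈0 : ∀ b → b ℕ.≤ n → ∀ β → All (0 ℕ.<_) β → Linked _≥_ (b ∷ β) → F (+ b ∷ map +_ β) ≈ᴹ 0ᴹ
    -- A leading 0 leaves no room for positive parts, and the vector (0) equals the empty one by
    -- padding.
    tail≈0 zero    b≤n []      _  _          = ≈ᴹ-trans (F-str .padded []) (F≈0 [] [] [-])
    tail≈0 zero    b≤n (x ∷ _) (x>0 ∷ _) (x≤0 ∷ _) = ⊥-elim (ℕₚ.<⇒≱ x>0 x≤0)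
    tail≈0 (suc b) b≤n β       β>0 β↓        = F≈0 (suc b ∷ β) (z<s ∷ β>0) (b≤n ∷ β↓)

  -- Insertion sort: entries are brought into decreasing order from the right.
  vanishes : ∀ {F} → Straightenable F →
             (∀ p → F (map +_ (parts p)) ≈ᴹ 0ᴹ) → ∀ α → F α ≈ᴹ 0ᴹ
  vanishes F-str F≈0 []      = F≈0 (record { parts = [] ; positive = [] ; decreasing = [] })
  -- The tail is sorted first, with `F ∘ (a ∷_)` in place of `F`; what remains is `a` in front of a
  -- partition, a single insertion.
  vanishes {F} F-str F≈0 (a ∷ α) = vanishes (straightenable-∷ F-str a) insert α
    where
    linked : ∀ {n} β → sum β ℕ.≤ n → Linked _≥_ β → Linked _≥_ (n ∷ β)
    linked []      _ _  = [-]
    linked (b ∷ β) l β↓ = ℕₚ.m+n≤o⇒m≤o b l ∷ β↓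

    insert : ∀ p → F (a ∷ map +_ (parts p)) ≈ᴹ 0ᴹ
    insert p = vanishes-insert F-str n
      (λ β β>0 β↓ → F≈0 (record { parts = β ; positive = β>0 ; decreasing = Linked.tail β↓ }))
      a (parts p) (ℤₚ.≤-trans (i≤∣i∣ a) (ℤ.+≤+ (ℕₚ.m≤m+n _ _))) (positive p)
      (linked (parts p) (ℕₚ.m≤n⇒m≤1+n (ℕₚ.m≤n+m _ _)) (decreasing p))
      where n = ℤ.∣ a ∣ ℕ.+ sum (parts p)

  straightenable-≈ : ∀ {F G} → Straightenable F → Straightenable G →
                     (∀ p → F (map +_ (parts p)) ≈ᴹ G (map +_ (parts p))) → ∀ α → F α ≈ᴹ G α
  straightenable-≈ {F} {G} F-str G-str F≈G α = begin
    F α                  ≈⟨ x∙y⁻¹≈ε⇒x≈y (F α) (G α)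
      (vanishes (straightenable-difference F-str G-str) (λ p → x≈y⇒x∙y⁻¹≈ε (F≈G p)) α) ⟩
    G α ∎
    where open AbelianGroupProperties +ᴹ-abelianGroup using (x∙y⁻¹≈ε⇒x≈y; x≈y⇒x∙y⁻¹≈ε)

-- Determinants of Jacobi-Trudi type.

entry-contract-0 : ∀ α r → entry (contract α 0) r ≡ entry α (suc r)
entry-contract-0 []      r = ≡.refl
entry-contract-0 (a ∷ α) r = ≡.refl

-- Rows before the deleted one are raised by one, rows after it move up one place. Either way the
-- row index αᵢ - i grows by one, which `pred` undoes; so the rows of the minor are those of the
-- contracted vector.
entry-contract : ∀ α {n} (i : Fin (suc n)) (r : Fin n) →
  ℤ.pred (entry (contract α (toℕ i)) (toℕ r) ℤ.- + toℕ r) ≡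
  entry α (toℕ (punchIn i r)) ℤ.- + toℕ (punchIn i r)
entry-contract α       zero    r       = ≡.trans
  (≡.cong (λ e → ℤ.pred (e ℤ.- + toℕ r)) (entry-contract-0 α (toℕ r)))
  (≡.sym (ℤₚ.minus-suc (entry α (suc (toℕ r))) (toℕ r)))
entry-contract []      (suc i) zero    = ≡.refl
entry-contract (a ∷ α) (suc i) zero    = ≡.trans
  (≡.cong ℤ.pred (ℤₚ.+-identityʳ (ℤ.suc a))) (≡.trans (ℤₚ.pred-suc a) (≡.sym (ℤₚ.+-identityʳ a)))
entry-contract []      (suc i) (suc r) = ≡.trans
  (≡.cong ℤ.pred (≡.trans (ℤₚ.minus-suc (entry (contract [] (toℕ i)) (toℕ r)) (toℕ r))
                              (entry-contract [] i r)))
  (≡.sym (ℤₚ.minus-suc (+ 0) (toℕ (punchIn i r))))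
entry-contract (a ∷ α) (suc i) (suc r) = ≡.trans
  (≡.cong ℤ.pred (≡.trans (ℤₚ.minus-suc (entry (contract α (toℕ i)) (toℕ r)) (toℕ r))
                              (entry-contract α i r)))
  (≡.sym (ℤₚ.minus-suc (entry α (toℕ (punchIn i r))) (toℕ (punchIn i r))))

module _ {R : CommutativeRing c ℓ} {M : LeftModule (CommutativeRing.ring R) m ℓm} where
  open LeftModule M
  open Straightening R M
  open AlternatingBelow

  alternating-cong : ∀ {N F G} → (∀ α → length α ℕ.< N → F α ≈ᴹ G α) →
                     AlternatingBelow N G → AlternatingBelow N F
  alternating-cong {N} F≈G G-alt .swap β a b γ l = ≈ᴹ-trans
    (+ᴹ-cong (F≈G _ (length-≡ a (ℤ.suc b) l)) (F≈G _ (length-≡ b (ℤ.suc a) l)))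
    (G-alt .swap β a b γ l)
    where
    length-≡ : ∀ x y → length (β ++ a ∷ b ∷ γ) ℕ.< N → length (β ++ x ∷ y ∷ γ) ℕ.< N
    length-≡ x y = ≡.subst (ℕ._< N) (≡.trans (Listₚ.length-++ β) (≡.sym (Listₚ.length-++ β)))
  alternating-cong {N} F≈G G-alt .repeat β a γ l = ≈ᴹ-trans
    (F≈G _ (≡.subst (ℕ._< N) (≡.trans (Listₚ.length-++ β) (≡.sym (Listₚ.length-++ β))) l))
    (G-alt .repeat β a γ l)

module JacobiTrudi (A : CommutativeRing c ℓ) where
  private module A = CommutativeRing A
  open Determinant A
  open Exp A.semiring using (_^_)
  open Straightening A (TensorUnit.leftModule {R = A.ring})
  open SetoidReasoning A.setoid

  det-cong : ∀ n {M M′ : Fin n → Fin n → A.Carrier} → (∀ i j → M i j A.≈ M′ i j) →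
             det n M A.≈ det n M′
  det-cong zero    M≈M′ = A.refl
  det-cong (suc n) M≈M′ = Sum.sum-cong-≋ A.+-commutativeMonoid {suc n} λ i →
    A.*-cong (A.*-congˡ {(A.- A.1#) ^ toℕ i} (M≈M′ i zero))
             (det-cong n λ r s → M≈M′ (punchIn i r) (suc s))

  jacobiTrudi : (ℤ → ℤ → A.Carrier) → ℕ → List ℤ → A.Carrier
  jacobiTrudi h N α = det N λ i j → h (+ toℕ j) (entry α (toℕ i) ℤ.- + toℕ i)

  -- contract raises the remaining rows by one, so the minors of the first column are again of
  -- Jacobi-Trudi form, for the shifted family.
  shift : (ℤ → ℤ → A.Carrier) → ℤ → ℤ → A.Carrier
  shift h r k = h (ℤ.suc r) (ℤ.pred k)

  jacobiTrudi-suc : ∀ h n α →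
    jacobiTrudi h (suc n) α A.≈ contraction (suc n) (h (+ 0)) (jacobiTrudi (shift h) n) α
  jacobiTrudi-suc h n α = Sum.sum-cong-≋ A.+-commutativeMonoid {suc n} λ i →
    A.*-congˡ {(A.- A.1#) ^ toℕ i A.* h (+ 0) (entry α (toℕ i) ℤ.- + toℕ i)}
      (det-cong n λ r s → A.reflexive (≡.cong (h (+ suc (toℕ s))) (≡.sym (entry-contract α i r))))

  jacobiTrudi-alternating : ∀ h N → AlternatingBelow (suc N) (jacobiTrudi h N)
  jacobiTrudi-alternating h zero = record
    { swap   = λ { [] a b γ (s≤s ()) ; (x ∷ β) a b γ (s≤s ()) }
    ; repeat = λ { [] a γ (s≤s ()) ; (x ∷ β) a γ (s≤s ()) } }
  jacobiTrudi-alternating h (suc n) = alternating-cong (λ α _ → jacobiTrudi-suc h n α)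
    (contraction-alternating (h (+ 0)) (jacobiTrudi (shift h) n) (jacobiTrudi-alternating (shift h) n))

  -- Both conditions pass to the shifted family, so an induction along first columns can use them at
  -- every stage.
  record Unitriangular (h : ℤ → ℤ → A.Carrier) : Set (c ⊔ ℓ) where
    field
      diagonal : ∀ k → h k (ℤ.- k) A.≈ A.1#
      below    : ∀ r k → k ℤ.+ r ℤ.< + 0 → h r k A.≈ A.0#
  open Unitriangular

  shift-unitriangular : ∀ {h} → Unitriangular h → Unitriangular (shift h)
  shift-unitriangular {h} u .diagonal k = A.trans
    (A.reflexive (≡.cong (h (ℤ.suc k)) (≡.sym (ℤₚ.neg-distrib-+ (+ 1) k)))) (u .diagonal (ℤ.suc k))
  shift-unitriangular {h} u .below r k l = u .below (ℤ.suc r) (ℤ.pred k)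
    (≡.subst (ℤ._< + 0) (≡.sym eq) l)
    where
    eq : ℤ.pred k ℤ.+ ℤ.suc r ≡ k ℤ.+ r
    eq = ≡.trans (≡.cong (ℤ._+ ℤ.suc r) (ℤₚ.+-comm (- + 1) k))
      (≡.trans (ℤₚ.+-assoc k (- + 1) (ℤ.suc r)) (≡.cong (ℤ._+_ k) (ℤₚ.pred-suc r)))

  -- The last row lies beyond the vector, so its first entry is zero and the last term of the
  -- expansion drops out; the other minors shrink by induction. At size 0 only the corner entry
  -- remains, which is 1.
  jacobiTrudi-extend : ∀ {h} → Unitriangular h → ∀ N α → length α ℕ.≤ N →
                       jacobiTrudi h (suc N) α A.≈ jacobiTrudi h N α
  jacobiTrudi-extend {h} u zero    [] _ = A.trans (A.+-identityʳ _)
    (A.trans (A.*-identityʳ _) (A.trans (A.*-identityˡ _) (u .diagonal (+ 0))))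
  jacobiTrudi-extend {h} u (suc N) α  l = begin
    jacobiTrudi h (suc (suc N)) α
      ≈⟨ jacobiTrudi-suc h (suc N) α ⟩
    contraction (suc (suc N)) (h (+ 0)) (jacobiTrudi (shift h) (suc N)) α
      ≈⟨ contraction-last (suc N) (h (+ 0)) (jacobiTrudi (shift h) (suc N)) α zero-weight ⟩
    contraction (suc N) (h (+ 0)) (jacobiTrudi (shift h) (suc N)) α
      ≈⟨ sum-cong< (suc N) {contraction-term (h (+ 0)) (jacobiTrudi (shift h) (suc N)) α}
           {contraction-term (h (+ 0)) (jacobiTrudi (shift h) N) α} (λ t t≤N → A.*-congˡ
           {(A.- A.1#) ^ t A.* h (+ 0) (entry α t ℤ.- + t)}
           (jacobiTrudi-extend (shift-unitriangular u) N (contract α t)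
             (ℕₚ.≤-pred (length-contract α t l t≤N)))) ⟩
    contraction (suc N) (h (+ 0)) (jacobiTrudi (shift h) N) α
      ≈⟨ jacobiTrudi-suc h N α ⟨
    jacobiTrudi h (suc N) α ∎
    where
    zero-weight : h (+ 0) (entry α (suc N) ℤ.- + suc N) A.≈ A.0#
    zero-weight rewrite entry-beyond α (suc N) l = u .below (+ 0) -[1+ N ] ℤ.-<+

  jacobiTrudi-stable : ∀ {h} → Unitriangular h → ∀ N α → length α ℕ.≤ N →
                       jacobiTrudi h N α A.≈ jacobiTrudi h (length α) α
  jacobiTrudi-stable {h} u N α l = go (ℕₚ.≤⇒≤′ l)
    where
    go : ∀ {N} → length α ℕ.≤′ N → jacobiTrudi h N α A.≈ jacobiTrudi h (length α) α
    go ℕ.≤′-refl           = A.refl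
    go (ℕ.≤′-step {N} l) = A.trans (jacobiTrudi-extend u N α (ℕₚ.≤′⇒≤ l)) (go l)

  -- The size of the determinant varies with the vector. Stability replaces it by a common size, at
  -- which alternation is known and a trailing zero changes no entry.
  jacobiTrudi-straightenable : ∀ {h} → Unitriangular h →
                               Straightenable (λ α → jacobiTrudi h (length α) α)
  jacobiTrudi-straightenable {h} u .alternating zero = record
    { swap = λ _ _ _ _ () ; repeat = λ _ _ _ () }
  jacobiTrudi-straightenable {h} u .alternating (suc N) = alternating-cong
    (λ α l → A.sym (jacobiTrudi-stable u N α (ℕₚ.≤-pred l))) (jacobiTrudi-alternating h N)
  jacobiTrudi-straightenable {h} u .padded α = begin
    jacobiTrudi h (length (α ++ + 0 ∷ [])) (α ++ + 0 ∷ [])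
      ≈⟨ det-cong (length (α ++ + 0 ∷ [])) (λ i j → A.reflexive
           (≡.cong (λ e → h (+ toℕ j) (e ℤ.- + toℕ i)) (entry-++0 α (toℕ i)))) ⟩
    jacobiTrudi h (length (α ++ + 0 ∷ [])) α
      ≈⟨ jacobiTrudi-stable u _ α (≡.subst (length α ℕ.≤_) (≡.sym (Listₚ.length-++ α)) (ℕₚ.m≤m+n _ _)) ⟩
    jacobiTrudi h (length α) α ∎

-- Linear maps.

module _ {R : CommutativeRing c ℓ} {M : LeftModule (CommutativeRing.ring R) m ℓm}
         {S : CommutativeRing c′ ℓ′} {N : LeftModule (CommutativeRing.ring S) m′ ℓm′} where
  private
    module M = LeftModule M
    module N = LeftModule N
    module SM = Straightening R M
    module SN = Straightening S N

  -- The conditions involve no scalars, so `T` may change the base ring. This covers b ↦ b z^m, from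
  -- B over itself to B[z, z⁻¹] over `K`.
  straightenable-map : (T : M.Carrierᴹ → N.Carrierᴹ) →
    (∀ {x y} → x M.≈ᴹ y → T x N.≈ᴹ T y) →
    (∀ x y → T (x M.+ᴹ y) N.≈ᴹ T x N.+ᴹ T y) → T M.0ᴹ N.≈ᴹ N.0ᴹ →
    ∀ {F} → SM.Straightenable F → SN.Straightenable (T ∘ F)
  straightenable-map T T-cong T-+ T-0 F-str = record
    { alternating = λ N → record
      { swap   = λ β a b γ l → N.≈ᴹ-trans (N.≈ᴹ-sym (T-+ _ _))
          (N.≈ᴹ-trans (T-cong (SM.AlternatingBelow.swap (SM.alternating F-str N) β a b γ l)) T-0)
      ; repeat = λ β a γ l →
          N.≈ᴹ-trans (T-cong (SM.AlternatingBelow.repeat (SM.alternating F-str N) β a γ l)) T-0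
      }
    ; padded = λ α → T-cong (SM.padded F-str α)
    }

module Linear {R : CommutativeRing c ℓ} (M : LeftModule (CommutativeRing.ring R) m ℓm) where
  private module R = CommutativeRing R
  open LeftModule M
  open AbelianGroupProperties +ᴹ-abelianGroup using (inverseˡ-unique)
  open CommutativeSemigroupProperties
    (CommutativeMonoid.commutativeSemigroup +ᴹ-commutativeMonoid) using (interchange)
  private module Σ = Sum +ᴹ-commutativeMonoid

  record IsLinear (T : Carrierᴹ → Carrierᴹ) : Set (c ⊔ m ⊔ ℓm) where
    field
      cong    : ∀ {x y} → x ≈ᴹ y → T x ≈ᴹ T y
      +-homo  : ∀ x y → T (x +ᴹ y) ≈ᴹ T x +ᴹ T y
      *ₗ-homo : ∀ a x → T (a *ₗ x) ≈ᴹ a *ₗ T x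

    0-homo : T 0ᴹ ≈ᴹ 0ᴹ
    0-homo = ≈ᴹ-trans (cong (≈ᴹ-sym (*ₗ-zeroˡ 0ᴹ))) (≈ᴹ-trans (*ₗ-homo R.0# 0ᴹ) (*ₗ-zeroˡ _))

    -‿homo : ∀ x → T (-ᴹ x) ≈ᴹ -ᴹ T x
    -‿homo x = inverseˡ-unique _ _ (≈ᴹ-trans (≈ᴹ-sym (+-homo (-ᴹ x) x))
      (≈ᴹ-trans (cong (-ᴹ‿inverseˡ x)) 0-homo))

    sum-homo : ∀ N (f : Fin N → Carrierᴹ) → T (Σ.sum f) ≈ᴹ Σ.sum (T ∘ f)
    sum-homo zero    f = 0-homo
    sum-homo (suc N) f = ≈ᴹ-trans (+-homo _ _) (+ᴹ-congˡ (sum-homo N (f ∘ suc)))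
  open IsLinear

  ∘-linear : ∀ {S T} → IsLinear S → IsLinear T → IsLinear (S ∘ T)
  ∘-linear S T .cong p        = S .cong (T .cong p)
  ∘-linear S T .+-homo x y    = ≈ᴹ-trans (S .cong (T .+-homo x y)) (S .+-homo _ _)
  ∘-linear S T .*ₗ-homo a x   = ≈ᴹ-trans (S .cong (T .*ₗ-homo a x)) (S .*ₗ-homo _ _)

  +-linear : ∀ {S T} → IsLinear S → IsLinear T → IsLinear (λ x → S x +ᴹ T x)
  +-linear S T .cong p        = +ᴹ-cong (S .cong p) (T .cong p)
  +-linear S T .+-homo x y    =
    ≈ᴹ-trans (+ᴹ-cong (S .+-homo x y) (T .+-homo x y)) (interchange _ _ _ _)
  +-linear S T .*ₗ-homo a x   =
    ≈ᴹ-trans (+ᴹ-cong (S .*ₗ-homo a x) (T .*ₗ-homo a x)) (≈ᴹ-sym (*ₗ-distribˡ a _ _))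

  *ₗ-linear : ∀ a → IsLinear (a *ₗ_)
  *ₗ-linear a .cong       = *ₗ-congˡ
  *ₗ-linear a .+-homo     = *ₗ-distribˡ a
  *ₗ-linear a .*ₗ-homo b x = ≈ᴹ-trans (≈ᴹ-sym (*ₗ-assoc a b x))
    (≈ᴹ-trans (*ₗ-congʳ (R.*-comm a b)) (*ₗ-assoc b a x))

  0-linear : IsLinear (λ _ → 0ᴹ)
  0-linear .cong _      = ≈ᴹ-refl
  0-linear .+-homo _ _  = ≈ᴹ-sym (+ᴹ-identityˡ 0ᴹ)
  0-linear .*ₗ-homo a _ = ≈ᴹ-sym (*ₗ-zeroʳ a)

  module _ {I : DecSetoid i ℓi} {v : DecSetoid.Carrier I → Carrierᴹ} (basis : IsBasis R M I v) where
    private module I = DecSetoid I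
    open FormalSum R I using (linearCombination)

    linearExtension-linear : ∀ f → (∀ {x y} → x I.≈ y → f x ≈ᴹ f y) →
                             IsLinear (linearExtension basis M f)
    linearExtension-linear f f-cong = record
      { cong = H.⟦⟧-cong ; +-homo = H.+ᴹ-homo ; *ₗ-homo = H.*ₗ-homo }
      where module H = LeftModuleMorphisms.IsLeftModuleHomomorphism
                         (linearExtension-isHomomorphism basis M f f-cong)

    linear-≈ : ∀ {S T} → IsLinear S → IsLinear T → (∀ x → S (v x) ≈ᴹ T (v x)) → ∀ u → S u ≈ᴹ T u
    linear-≈ {S} {T} S-lin T-lin S≈T u with IsBasis.spanning basis u
    ... | xs , xs≈u = ≈ᴹ-trans (S-lin .cong (≈ᴹ-sym xs≈u)) (≈ᴹ-trans (go xs) (T-lin .cong xs≈u))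
      where
      go : ∀ xs → S (linearCombination M v xs) ≈ᴹ T (linearCombination M v xs)
      go []             = ≈ᴹ-trans (0-homo S-lin) (≈ᴹ-sym (0-homo T-lin))
      go ((a , x) ∷ xs) = ≈ᴹ-trans (S-lin .+-homo _ _) (≈ᴹ-trans
        (+ᴹ-cong (≈ᴹ-trans (S-lin .*ₗ-homo a _) (≈ᴹ-trans (*ₗ-congˡ (S≈T x)) (≈ᴹ-sym (T-lin .*ₗ-homo a _))))
                 (go xs))
        (≈ᴹ-sym (T-lin .+-homo _ _)))

-- Conjugate partitions.

columnLength : List ℕ → ℕ → ℕ
columnLength α j = length (filter (suc j ℕₚ.≤?_) α)

columnLength-zero : ∀ {α n j} → Linked _≥_ (n ∷ α) → n ℕ.≤ j → columnLength α j ≡ 0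
columnLength-zero {[]}    α↓ n≤j = ≡.refl
columnLength-zero {b ∷ α} {j = j} (b≤n ∷ α↓) n≤j = ≡.cong length
  (Listₚ.filter-none (suc j ℕₚ.≤?_) (All.map (λ x≤n 1+j≤x → ℕₚ.<⇒≱ 1+j≤x (ℕₚ.≤-trans x≤n n≤j))
    (Linked⇒All (λ p q → ℕₚ.≤-trans q p) b≤n α↓)))

-- One presentation for both clauses of `conjugate`: `n` is the first part, or 0 for the empty list.
conjugate-applyUpTo : ∀ α → ∃ λ n → conjugate α ≡ applyUpTo (columnLength α) n
                    × (∀ {a} → Linked _≥_ (a ∷ α) → n ℕ.≤ a)
                    × (∀ {j} → Linked _≥_ α → n ℕ.≤ j → columnLength α j ≡ 0)
conjugate-applyUpTo []      = 0 , ≡.refl , (λ _ → z≤n) , (λ _ _ → ≡.refl)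
conjugate-applyUpTo (b ∷ α) = b , ≡.refl , Linked.head , λ α↓ → columnLength-zero (ℕₚ.≤-refl ∷ α↓)

length-conjugate : ∀ {a α} → Linked _≥_ (a ∷ α) → length (conjugate α) ℕ.≤ a
length-conjugate {a} {α} α↓ with conjugate-applyUpTo α
... | n , eq , n≤a , _ rewrite eq | Listₚ.length-applyUpTo (columnLength α) n = n≤a α↓

applyUpTo-cong : ∀ {f g : ℕ → ℕ} n → (∀ j → j ℕ.< n → f j ≡ g j) → applyUpTo f n ≡ applyUpTo g n
applyUpTo-cong zero    f≡g = ≡.refl
applyUpTo-cong (suc n) f≡g =
  ≡.cong₂ _∷_ (f≡g 0 z<s) (applyUpTo-cong n λ j j<n → f≡g (suc j) (s<s j<n))

-- The deleted place `a` lies among the implicit zeros. Those before it become 1, which is `suc ∘ f`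
-- there since `f` vanishes from `n` on.
contract-applyUpTo : ∀ (f : ℕ → ℕ) n a → n ℕ.≤ a → (∀ j → n ℕ.≤ j → f j ≡ 0) →
  contract (map +_ (applyUpTo f n)) a ≡ map +_ (applyUpTo (suc ∘ f) a)
contract-applyUpTo f zero    zero    _ _ = ≡.refl
contract-applyUpTo f zero    (suc a) _ f≡0 = ≡.cong₂ _∷_
  (≡.cong (λ x → + suc x) (≡.sym (f≡0 0 z≤n)))
  (contract-applyUpTo (f ∘ suc) zero a z≤n λ j _ → f≡0 (suc j) z≤n)
contract-applyUpTo f (suc n) (suc a) (s≤s n≤a) f≡0 =
  ≡.cong (ℤ.suc (+ f 0) ∷_) (contract-applyUpTo (f ∘ suc) n a n≤a λ j n≤j → f≡0 (suc j) (s≤s n≤j))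

-- Adding a first row of length a ≥ λ₁ lengthens each of the first a columns by one box.
contract-conjugate : ∀ {a α} → Linked _≥_ (a ∷ α) →
  contract (map +_ (conjugate α)) a ≡ map +_ (conjugate (a ∷ α))
contract-conjugate {a} {α} α↓ with conjugate-applyUpTo α
... | n , eq , n≤a , column≡0 = ≡.trans (≡.cong (λ μ → contract (map +_ μ) a) eq) (≡.trans
  (contract-applyUpTo (columnLength α) n a (n≤a α↓) (λ j → column≡0 (Linked.tail α↓)))
  (≡.cong (map +_) (applyUpTo-cong a λ j j<a →
    ≡.sym (≡.cong length (Listₚ.filter-accept (suc j ℕₚ.≤?_) j<a)))))

-- The operators on an abstract Fock space.

-- s α m stands for s_α z^m; in this generality 𝓑 can stay abstract.
module Fock (K : CommutativeRing c ℓ) (V : LeftModule (CommutativeRing.ring K) m ℓm)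
  (s : List ℤ → ℤ → LeftModule.Carrierᴹ V)
  (s-straightenable : ∀ m → Straightening.Straightenable K V (λ α → s α m))
  (basis : IsBasis K V (×-decSetoid Partition-decSetoid (≡.decSetoid ℤₚ._≟_))
             (λ (p , m) → s (map +_ (parts p)) m)) where
  private module K = CommutativeRing K
  open LeftModule V
  open Straightening K V
  open Linear {R = K} V
  open IsLinear
  open Exp K.semiring using (_^_; ^-homo-*)
  open SetoidReasoning ≈ᴹ-setoid
  private module Σ = Sum +ᴹ-commutativeMonoid

  -- This and the next definitions mirror those in `Fermions`, so that at the concrete `s` they
  -- agree by computation and the relations transfer as they stand.
  δ : ℤ → ℤ → K.Carrier
  δ k l = if does (k ℤₚ.≟ l) then K.1# else K.0#

  sign : ℕ → K.Carrier
  sign n = (K.- K.1#) ^ n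

  δ-≡ : ∀ {k l} → k ≡ l → δ k l K.≈ K.1#
  δ-≡ {k} {l} eq with k ℤₚ.≟ l
  ... | yes _ = K.refl
  ... | no ne = ⊥-elim (ne eq)

  δ-≢ : ∀ k l → k ≢ l → δ k l K.≈ K.0#
  δ-≢ k l ne with k ℤₚ.≟ l
  ... | yes eq = ⊥-elim (ne eq)
  ... | no _   = K.refl

  δ-cong : ∀ k l k′ l′ → (k ≡ l → k′ ≡ l′) → (k′ ≡ l′ → k ≡ l) → δ k l K.≈ δ k′ l′
  δ-cong k l k′ l′ f g with k ℤₚ.≟ l
  ... | yes eq = K.sym (δ-≡ (f eq))
  ... | no ne  = K.sym (δ-≢ k′ l′ (ne ∘ g))

  ψ-value : ℤ → List ℤ → ℤ → Carrierᴹ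
  ψ-value k α m = s (k ℤ.- m ℤ.- + 1 ∷ α) (m ℤ.+ + 1)

  ψ : ℤ → Carrierᴹ → Carrierᴹ
  ψ k = linearExtension basis V λ (p , m) → ψ-value k (map +_ (parts p)) m

  ψ*-term : ℤ → List ℤ → ℤ → ℕ → Carrierᴹ
  ψ*-term k α m t =
    (sign t K.* δ (k ℤ.- m ℤ.- + 1) (entry α t ℤ.- + suc t)) *ₗ s (contract α t) (m ℤ.- + 1)

  ψ*-value : ℤ → List ℤ → ℤ → Carrierᴹ
  ψ*-value k α m = Σ.sum {length α ℕ.+ ℤ.∣ k ℤ.- m ℤ.- + 1 ∣} (ψ*-term k α m ∘ toℕ)

  ψ* : ℤ → Carrierᴹ → Carrierᴹ
  ψ* k = linearExtension basis V λ (p , m) → ψ*-value k (map +_ (parts p)) m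

  private
    parts-cong : (g : List ℤ → ℤ → Carrierᴹ) {p q : Partition} {m n : ℤ} →
                 parts p ≡ parts q → m ≡ n → g (map +_ (parts p)) m ≈ᴹ g (map +_ (parts q)) n
    parts-cong g p≡q m≡n = ≈ᴹ-reflexive (≡.cong₂ (λ ps → g (map +_ ps)) p≡q m≡n)

  module _ (g : List ℤ → ℤ → Carrierᴹ) where
    private
      f : Partition × ℤ → Carrierᴹ
      f (p , m) = g (map +_ (parts p)) m

    extension-linear : IsLinear (linearExtension basis V f)
    extension-linear = linearExtension-linear basis f
      λ {x} {y} (p≡q , m≡n) → parts-cong g {proj₁ x} {proj₁ y} p≡q m≡n

    extension-basis : ∀ p m → linearExtension basis V f (s (map +_ (parts p)) m) ≈ᴹ g (map +_ (parts p)) m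
    extension-basis p m = linearExtension-basis basis V f
      (λ {x} {y} (p≡q , m≡n) → parts-cong g {proj₁ x} {proj₁ y} p≡q m≡n) (p , m)

    extension-s : (∀ m → Straightenable (λ α → g α m)) →
                  ∀ α m → linearExtension basis V f (s α m) ≈ᴹ g α m
    extension-s g-str α m = straightenable-≈
      (straightenable-map {M = V} {N = V} (linearExtension basis V f) (extension-linear .cong)
        (extension-linear .+-homo) (0-homo extension-linear) (s-straightenable m))
      (g-str m) (λ p → extension-basis p m) α

  ψ-linear : ∀ k → IsLinear (ψ k)
  ψ-linear k = extension-linear (ψ-value k)

  ψ*-linear : ∀ k → IsLinear (ψ* k)
  ψ*-linear k = extension-linear (ψ*-value k)

  ψ-s : ∀ k α m → ψ k (s α m) ≈ᴹ s (k ℤ.- m ℤ.- + 1 ∷ α) (m ℤ.+ + 1)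
  ψ-s k = extension-s (ψ-value k) λ m →
    straightenable-∷ (s-straightenable (m ℤ.+ + 1)) (k ℤ.- m ℤ.- + 1)

  -- `contraction` reads the row as α_t - t and `ψ*-term` as α_t - (t + 1), with t counted from 0;
  -- `pred` reconciles them.
  weight : ℤ → ℤ → ℤ → K.Carrier
  weight k m r = δ (k ℤ.- m ℤ.- + 1) (ℤ.pred r)

  -- This frees the number of terms from the vector: past the bound the row is -(t+1) with t at
  -- least |k - m - 1|, too negative for δ to be nonzero.
  ψ*-contraction : ∀ k α m N → length α ℕ.+ ℤ.∣ k ℤ.- m ℤ.- + 1 ∣ ℕ.≤ N →
    ψ*-value k α m ≈ᴹ contraction N (weight k m) (λ β → s β (m ℤ.- + 1)) α
  ψ*-contraction k α m N l = go (ℕₚ.≤⇒≤′ l)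
    where
    d = k ℤ.- m ℤ.- + 1
    F = λ β → s β (m ℤ.- + 1)

    weight-beyond : ∀ N → length α ℕ.+ ℤ.∣ d ∣ ℕ.≤ N → weight k m (entry α N ℤ.- + N) K.≈ K.0#
    weight-beyond N l = δ-≢ d (ℤ.pred (entry α N ℤ.- + N)) λ eq → ℕₚ.<-irrefl
      (≡.cong ℤ.∣_∣ (≡.trans eq (≡.trans
        (≡.cong (λ e → ℤ.pred (e ℤ.- + N)) (entry-beyond α N (ℕₚ.≤-trans (ℕₚ.m≤m+n _ ℤ.∣ d ∣) l)))
        (≡.sym (ℤₚ.minus-suc (+ 0) N)))))
      (s≤s (ℕₚ.≤-trans (ℕₚ.m≤n+m _ (length α)) l))

    go : ∀ {N} → length α ℕ.+ ℤ.∣ d ∣ ℕ.≤′ N → ψ*-value k α m ≈ᴹ contraction N (weight k m) F α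
    go ℕ.≤′-refl = sum-cong< (length α ℕ.+ ℤ.∣ d ∣) {ψ*-term k α m} {contraction-term (weight k m) F α}
      λ t _ → *ₗ-congʳ (K.*-congˡ (K.reflexive (≡.cong (δ d) (ℤₚ.minus-suc (entry α t) t))))
    go (ℕ.≤′-step {N} l) = ≈ᴹ-trans (go l)
      (≈ᴹ-sym (contraction-last N (weight k m) F α (weight-beyond N (ℕₚ.≤′⇒≤ l))))

  -- With `N ℕ.+ e` terms the sum is correct for all vectors shorter than `N` at once, so that
  -- alternation of a contraction of fixed size applies.
  ψ*-value-straightenable : ∀ k m → Straightenable (λ α → ψ*-value k α m)
  ψ*-value-straightenable k m = record
    { alternating = λ N → alternating-cong {M = V}
        (λ α l → ψ*-contraction k α m (N ℕ.+ e) (ℕₚ.+-monoˡ-≤ e (ℕₚ.<⇒≤ l)))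
        (alternating-≤ (ℕₚ.m≤n⇒m≤1+n (ℕₚ.m≤m+n N e))
          (contraction-alternating (weight k m) F (alternating (s-straightenable _) (N ℕ.+ e))))
    ; padded = λ α → begin
        ψ*-value k (α ++ + 0 ∷ []) m
          ≈⟨ ψ*-contraction k (α ++ + 0 ∷ []) m (N α) ℕₚ.≤-refl ⟩
        contraction (N α) (weight k m) F (α ++ + 0 ∷ [])
          ≈⟨ contraction-padded (N α) (weight k m) F (padded (s-straightenable _)) α ⟩
        contraction (N α) (weight k m) F α
          ≈⟨ ψ*-contraction k α m (N α) (ℕₚ.+-monoˡ-≤ e
               (≡.subst (length α ℕ.≤_) (≡.sym (Listₚ.length-++ α)) (ℕₚ.m≤m+n _ 1))) ⟨
        ψ*-value k α m ∎
    }
    where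
    F = λ β → s β (m ℤ.- + 1)
    e = ℤ.∣ k ℤ.- m ℤ.- + 1 ∣
    N : List ℤ → ℕ
    N α = length (α ++ + 0 ∷ []) ℕ.+ e

    alternating-≤ : ∀ {M N F} → M ℕ.≤ N → AlternatingBelow N F → AlternatingBelow M F
    alternating-≤ M≤N F-alt = record
      { swap   = λ β a b γ l → AlternatingBelow.swap F-alt β a b γ (ℕₚ.<-≤-trans l M≤N)
      ; repeat = λ β a γ l → AlternatingBelow.repeat F-alt β a γ (ℕₚ.<-≤-trans l M≤N) }

  ψ*-s : ∀ k α m N → length α ℕ.+ ℤ.∣ k ℤ.- m ℤ.- + 1 ∣ ℕ.≤ N →
         ψ* k (s α m) ≈ᴹ contraction N (weight k m) (λ β → s β (m ℤ.- + 1)) α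
  ψ*-s k α m N l = ≈ᴹ-trans
    (extension-s (ψ*-value k) (ψ*-value-straightenable k) α m) (ψ*-contraction k α m N l)

  s-cong : ∀ {a b m n} α → a ≡ b → m ≡ n → s (a ∷ α) m ≈ᴹ s (b ∷ α) n
  s-cong α ≡.refl ≡.refl = ≈ᴹ-refl

  -- The operator applied second meets z^(m+1) and hence an index lower by one. This shift produces
  -- exactly the two vectors compared by `swap`.
  ψψ : ∀ k l x → ψ k (ψ l x) +ᴹ ψ l (ψ k x) ≈ᴹ 0ᴹ
  ψψ k l = linear-≈ basis
    (+-linear (∘-linear (ψ-linear k) (ψ-linear l)) (∘-linear (ψ-linear l) (ψ-linear k)))
    0-linear λ (p , m) → let α = map +_ (parts p) in
      ≈ᴹ-trans (+ᴹ-cong (expand k l α m) (expand l k α m))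
        (AlternatingBelow.swap (alternating (s-straightenable (m ℤ.+ + 1 ℤ.+ + 1)) _)
          [] (k ℤ.- (m ℤ.+ + 1) ℤ.- + 1) (l ℤ.- (m ℤ.+ + 1) ℤ.- + 1) α ℕₚ.≤-refl)
    where
    suc-index : ∀ l m → l ℤ.- m ℤ.- + 1 ≡ + 1 ℤ.+ (l ℤ.- (m ℤ.+ + 1) ℤ.- + 1)
    suc-index = solve-∀

    expand : ∀ k l α m → ψ k (ψ l (s α m)) ≈ᴹ
      s (k ℤ.- (m ℤ.+ + 1) ℤ.- + 1 ∷ ℤ.suc (l ℤ.- (m ℤ.+ + 1) ℤ.- + 1) ∷ α) (m ℤ.+ + 1 ℤ.+ + 1)
    expand k l α m = ≈ᴹ-trans
      (ψ-linear k .cong (≈ᴹ-trans (ψ-s l α m) (s-cong α (suc-index l m) ≡.refl)))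
      (ψ-s k _ (m ℤ.+ + 1))

  ψψ* : ∀ k l x → ψ k (ψ* l x) +ᴹ ψ* l (ψ k x) ≈ᴹ δ k l *ₗ x
  ψψ* k l = linear-≈ basis
    (+-linear (∘-linear (ψ-linear k) (ψ*-linear l)) (∘-linear (ψ*-linear l) (ψ-linear k)))
    (*ₗ-linear (δ k l)) λ (p , m) → on-s (map +_ (parts p)) m
    where
    on-s : ∀ α m → ψ k (ψ* l (s α m)) +ᴹ ψ* l (ψ k (s α m)) ≈ᴹ δ k l *ₗ s α m
    on-s α m = begin
      ψ k (ψ* l (s α m)) +ᴹ ψ* l (ψ k (s α m))
        ≈⟨ +ᴹ-cong ψψ*-s ψ*ψ-s ⟩
      X +ᴹ (δ k l *ₗ s α m -ᴹ X)
        ≈⟨ +ᴹ-congˡ (+ᴹ-comm _ _) ⟩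
      X +ᴹ (-ᴹ X +ᴹ δ k l *ₗ s α m)
        ≈⟨ +ᴹ-assoc _ _ _ ⟨
      X -ᴹ X +ᴹ δ k l *ₗ s α m
        ≈⟨ +ᴹ-congʳ (-ᴹ‿inverseʳ X) ⟩
      0ᴹ +ᴹ δ k l *ₗ s α m
        ≈⟨ +ᴹ-identityˡ _ ⟩
      δ k l *ₗ s α m ∎
      where
      a = k ℤ.- m ℤ.- + 1
      -- Enough terms for `ψ* l` on `α` at z^m and, with one more, on `a ∷ α` at z^(m+1).
      N = length α ℕ.+ ℤ.∣ l ℤ.- m ℤ.- + 1 ∣ ℕ.+ ℤ.∣ l ℤ.- (m ℤ.+ + 1) ℤ.- + 1 ∣
      w = weight l (m ℤ.+ + 1) ∘ ℤ.pred
      F G : List ℤ → Carrierᴹ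
      F β = s β (m ℤ.- + 1)
      G β = s (ℤ.suc a ∷ β) (m ℤ.+ + 1 ℤ.- + 1)
      -- The common part of both orders: after `ψ* l` has lowered the power of z, `ψ k` prepends k -
      -- m = `suc a`, just what contraction makes of a leading `a`.
      X = contraction N w G α

      index : ∀ k m → k ℤ.- (m ℤ.- + 1) ℤ.- + 1 ≡ + 1 ℤ.+ (k ℤ.- m ℤ.- + 1)
      index = solve-∀
      exponent : ∀ m → m ℤ.- + 1 ℤ.+ + 1 ≡ m ℤ.+ + 1 ℤ.- + 1
      exponent = solve-∀
      exponent′ : ∀ m → m ℤ.+ + 1 ℤ.- + 1 ≡ m
      exponent′ = solve-∀
      pred-index : ∀ l m → l ℤ.- (m ℤ.+ + 1) ℤ.- + 1 ≡ (- + 1) ℤ.+ (l ℤ.- m ℤ.- + 1)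
      pred-index = solve-∀
      cancel-index : ∀ k m → (k ℤ.- m ℤ.- + 1) ℤ.+ (m ℤ.+ + 1) ≡ k
      cancel-index = solve-∀

      pred-injective : ∀ i j → ℤ.pred i ≡ ℤ.pred j → i ≡ j
      pred-injective i j eq =
        ≡.trans (≡.sym (ℤₚ.suc-pred i)) (≡.trans (≡.cong ℤ.suc eq) (ℤₚ.suc-pred j))

      weight-pred : ∀ r → weight l (m ℤ.+ + 1) r K.≈ δ (l ℤ.- m ℤ.- + 1) r
      weight-pred r = δ-cong (l ℤ.- (m ℤ.+ + 1) ℤ.- + 1) (ℤ.pred r) (l ℤ.- m ℤ.- + 1) r
        (λ eq → pred-injective (l ℤ.- m ℤ.- + 1) r (≡.trans (≡.sym (pred-index l m)) eq))
        (λ eq → ≡.trans (pred-index l m) (≡.cong ℤ.pred eq))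

      ψψ*-s : ψ k (ψ* l (s α m)) ≈ᴹ X
      ψψ*-s = begin
        ψ k (ψ* l (s α m))
          ≈⟨ ψ-linear k .cong (ψ*-s l α m N (ℕₚ.m≤m+n _ _)) ⟩
        ψ k (contraction N (weight l m) F α)
          ≈⟨ sum-homo (ψ-linear k) N (contraction-term (weight l m) F α ∘ toℕ) ⟩
        Σ.sum {N} (ψ k ∘ contraction-term (weight l m) F α ∘ toℕ)
          ≈⟨ sum-cong< N {ψ k ∘ contraction-term (weight l m) F α} {contraction-term w G α} (λ t _ →
               ≈ᴹ-trans (ψ-linear k .*ₗ-homo _ _)
                 (*ₗ-cong (K.*-congˡ (K.sym (weight-pred _)))
                   (≈ᴹ-trans (ψ-s k (contract α t) (m ℤ.- + 1))
                     (s-cong (contract α t) (index k m) (exponent m))))) ⟩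
        X ∎

      ψ*ψ-s : ψ* l (ψ k (s α m)) ≈ᴹ δ k l *ₗ s α m -ᴹ X
      ψ*ψ-s = begin
        ψ* l (ψ k (s α m))
          ≈⟨ ψ*-linear l .cong (ψ-s k α m) ⟩
        ψ* l (s (a ∷ α) (m ℤ.+ + 1))
          ≈⟨ ψ*-s l (a ∷ α) (m ℤ.+ + 1) (suc N)
               (s≤s (ℕₚ.+-monoˡ-≤ ℤ.∣ l ℤ.- (m ℤ.+ + 1) ℤ.- + 1 ∣ (ℕₚ.m≤m+n (length α) _))) ⟩
        contraction (suc N) (weight l (m ℤ.+ + 1)) (λ β → s β (m ℤ.+ + 1 ℤ.- + 1)) (a ∷ α)
          ≈⟨ contraction-∷ N (weight l (m ℤ.+ + 1)) (λ β → s β (m ℤ.+ + 1 ℤ.- + 1)) a α ⟩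
        weight l (m ℤ.+ + 1) a *ₗ s α (m ℤ.+ + 1 ℤ.- + 1) -ᴹ X
          ≈⟨ +ᴹ-congʳ (*ₗ-cong (K.trans (weight-pred a) (δ-cong (l ℤ.- m ℤ.- + 1) a k l
               (λ eq → ≡.trans (≡.sym (cancel-index k m)) (≡.trans
                 (≡.cong (ℤ._+ (m ℤ.+ + 1)) (≡.sym eq)) (cancel-index l m)))
               (λ { ≡.refl → ≡.refl })))
               (≈ᴹ-reflexive (≡.cong (s α) (exponent′ m)))) ⟩
        δ k l *ₗ s α m -ᴹ X ∎

  ψ*ψ* : ∀ k l x → ψ* k (ψ* l x) +ᴹ ψ* l (ψ* k x) ≈ᴹ 0ᴹ
  ψ*ψ* k l = linear-≈ basis
    (+-linear (∘-linear (ψ*-linear k) (ψ*-linear l)) (∘-linear (ψ*-linear l) (ψ*-linear k)))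
    0-linear λ (p , m) → on-s (map +_ (parts p)) m
    where
    Annihilated : Carrierᴹ → Set ℓm
    Annihilated x = ψ* k (ψ* l x) +ᴹ ψ* l (ψ* k x) ≈ᴹ 0ᴹ

    annihilated-cong : ∀ {x y} → x ≈ᴹ y → Annihilated x → Annihilated y
    annihilated-cong x≈y = ≈ᴹ-trans (≈ᴹ-sym (+-linear (∘-linear (ψ*-linear k) (ψ*-linear l))
      (∘-linear (ψ*-linear l) (ψ*-linear k)) .cong x≈y))

    ψ*ψ : ∀ j l x → ψ* l (ψ j x) ≈ᴹ δ j l *ₗ x -ᴹ ψ j (ψ* l x)
    ψ*ψ j l x = begin
      ψ* l (ψ j x)
        ≈⟨ +ᴹ-identityʳ _ ⟨
      ψ* l (ψ j x) +ᴹ 0ᴹ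
        ≈⟨ +ᴹ-congˡ (-ᴹ‿inverseʳ _) ⟨
      ψ* l (ψ j x) +ᴹ (ψ j (ψ* l x) -ᴹ ψ j (ψ* l x))
        ≈⟨ +ᴹ-assoc _ _ _ ⟨
      ψ* l (ψ j x) +ᴹ ψ j (ψ* l x) -ᴹ ψ j (ψ* l x)
        ≈⟨ +ᴹ-congʳ (≈ᴹ-trans (+ᴹ-comm _ _) (ψψ* j l x)) ⟩
      δ j l *ₗ x -ᴹ ψ j (ψ* l x) ∎

    -- Moving `ψ j` to the left past both `ψ*` leaves two δ-terms, which cancel between the two
    -- orders, and `ψ j` of an expression that is zero.
    annihilated-ψ : ∀ j x → Annihilated x → Annihilated (ψ j x)
    annihilated-ψ j x x-ann = ≈ᴹ-trans (+ᴹ-cong (move k l) (move l k))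
      (cancel ≈ᴹ-refl ≈ᴹ-refl
        (≈ᴹ-trans (≈ᴹ-sym (ψ-linear j .+-homo _ _))
          (≈ᴹ-trans (ψ-linear j .cong x-ann) (0-homo (ψ-linear j)))))
      where
      move : ∀ k l → ψ* k (ψ* l (ψ j x)) ≈ᴹ
                     δ j l *ₗ ψ* k x -ᴹ (δ j k *ₗ ψ* l x -ᴹ ψ j (ψ* k (ψ* l x)))
      move k l = begin
        ψ* k (ψ* l (ψ j x))
          ≈⟨ ψ*-linear k .cong (ψ*ψ j l x) ⟩
        ψ* k (δ j l *ₗ x -ᴹ ψ j (ψ* l x))
          ≈⟨ ψ*-linear k .+-homo _ _ ⟩
        ψ* k (δ j l *ₗ x) +ᴹ ψ* k (-ᴹ ψ j (ψ* l x))
          ≈⟨ +ᴹ-cong (ψ*-linear k .*ₗ-homo _ _) (-‿homo (ψ*-linear k) _) ⟩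
        δ j l *ₗ ψ* k x -ᴹ ψ* k (ψ j (ψ* l x))
          ≈⟨ +ᴹ-congˡ (-ᴹ‿cong (ψ*ψ j k (ψ* l x))) ⟩
        δ j l *ₗ ψ* k x -ᴹ (δ j k *ₗ ψ* l x -ᴹ ψ j (ψ* k (ψ* l x))) ∎

    -- The rows of the empty vector are -1, -2, ..., whereas m < k makes k - m - 1 nonnegative.
    ψ*-vacuum : ∀ k m → m ℤ.< k → ψ* k (s [] m) ≈ᴹ 0ᴹ
    ψ*-vacuum k m m<k = ≈ᴹ-trans (ψ*-s k [] m N ℕₚ.≤-refl)
      (sum-zero N {contraction-term (weight k m) (λ β → s β (m ℤ.- + 1)) []} λ t _ →
        ≈ᴹ-trans (*ₗ-congʳ (K.trans (K.*-congˡ (weight≈0 t)) (K.zeroʳ _))) (*ₗ-zeroˡ _))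
      where
      N = ℤ.∣ k ℤ.- m ℤ.- + 1 ∣

      index : ∀ k m → k ℤ.- (+ 1 ℤ.+ m) ≡ k ℤ.- m ℤ.- + 1
      index = solve-∀

      index≢ : ∀ t → k ℤ.- m ℤ.- + 1 ≢ ℤ.pred (+ 0 ℤ.- + t)
      index≢ t eq with ≡.subst (+ 0 ℤ.≤_) (≡.trans (index k m) (≡.trans eq (≡.sym (ℤₚ.minus-suc (+ 0) t))))
                       (ℤₚ.i≤j⇒0≤j-i (ℤₚ.i<j⇒suc[i]≤j m<k))
      ... | ()

      weight≈0 : ∀ t → weight k m (+ 0 ℤ.- + t) K.≈ K.0#
      weight≈0 t = δ-≢ (k ℤ.- m ℤ.- + 1) (ℤ.pred (+ 0 ℤ.- + t)) (index≢ t)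

    -- The index j of the operator solves j - (m - 1) - 1 = a.
    s-∷ : ∀ a α m → ψ (a ℤ.+ m) (s α (m ℤ.- + 1)) ≈ᴹ s (a ∷ α) m
    s-∷ a α m = ≈ᴹ-trans (ψ-s (a ℤ.+ m) α (m ℤ.- + 1)) (s-cong α (index a m) (exponent m))
      where
      index : ∀ a m → a ℤ.+ m ℤ.- (m ℤ.- + 1) ℤ.- + 1 ≡ a
      index = solve-∀
      exponent : ∀ m → m ℤ.- + 1 ℤ.+ + 1 ≡ m
      exponent = solve-∀

    -- s_∅ = s_(0) allows to lower the power of z arbitrarily far.
    vacuum : ∀ d m → m ℤ.< k ℤ.+ + d → m ℤ.< l ℤ.+ + d → Annihilated (s [] m)
    vacuum zero m m<k m<l = ≈ᴹ-trans
      (+ᴹ-cong (≈ᴹ-trans (ψ*-linear k .cong (ψ*-vacuum l m (≡.subst (m ℤ.<_) (ℤₚ.+-identityʳ l) m<l)))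
                         (0-homo (ψ*-linear k)))
               (≈ᴹ-trans (ψ*-linear l .cong (ψ*-vacuum k m (≡.subst (m ℤ.<_) (ℤₚ.+-identityʳ k) m<k)))
                         (0-homo (ψ*-linear l))))
      (+ᴹ-identityˡ 0ᴹ)
    vacuum (suc d) m m<k m<l = annihilated-cong
      (≈ᴹ-trans (s-∷ (+ 0) [] m) (padded (s-straightenable m) []))
      (annihilated-ψ (+ 0 ℤ.+ m) _ (vacuum d (m ℤ.- + 1) (lower k m<k) (lower l m<l)))
      where
      drop-suc : ∀ k d → k ℤ.+ (+ 1 ℤ.+ d) ℤ.- + 1 ≡ k ℤ.+ d
      drop-suc = solve-∀

      lower : ∀ k → m ℤ.< k ℤ.+ + suc d → m ℤ.- + 1 ℤ.< k ℤ.+ + d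
      lower k m<k = ≡.subst (m ℤ.- + 1 ℤ.<_) (drop-suc k (+ d)) (ℤₚ.+-monoˡ-< (- + 1) m<k)

    bound : ∀ k e m → ℤ.∣ m ℤ.- k ∣ ℕ.≤ e → m ℤ.< k ℤ.+ + suc e
    bound k e m l = ≡.subst (ℤ._< k ℤ.+ + suc e) (difference k m)
      (ℤₚ.+-monoʳ-< k (ℤₚ.≤-<-trans (i≤∣i∣ (m ℤ.- k)) (ℤ.+<+ (s≤s l))))
      where
      difference : ∀ k m → k ℤ.+ (m ℤ.- k) ≡ m
      difference = solve-∀

    on-s : ∀ α m → Annihilated (s α m)
    -- The sum of both distances lets a single descent end below `k` and below `l`.
    on-s []      m = vacuum (suc (ℤ.∣ m ℤ.- k ∣ ℕ.+ ℤ.∣ m ℤ.- l ∣)) m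
      (bound k _ m (ℕₚ.m≤m+n _ _)) (bound l _ m (ℕₚ.m≤n+m _ _))
    on-s (a ∷ α) m = annihilated-cong (s-∷ a α m) (annihilated-ψ (a ℤ.+ m) _ (on-s α (m ℤ.- + 1)))

  ψ-row : ∀ a β → ψ (+ a ℤ.+ + suc (length β)) (s (map +_ β) (+ length β)) ≈ᴹ
                  s (map +_ (a ∷ β)) (+ suc (length β))
  ψ-row a β = ≈ᴹ-trans (ψ-s (+ a ℤ.+ + suc n) (map +_ β) (+ n))
    (s-cong (map +_ β) (index (+ a) (+ n)) (≡.cong +_ (ℕₚ.+-comm n 1)))
    where
    n = length β
    index : ∀ a n → a ℤ.+ (+ 1 ℤ.+ n) ℤ.- n ℤ.- + 1 ≡ a
    index = solve-∀

  -- With t counted from 1, μ_t - t = -a-1 holds only for t = a + 1.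
  ψ*-column : ∀ μ n m a → length μ ℕ.≤ a → n ℤ.- m ℤ.- + 1 ≡ -[1+ a ] →
    ψ* n (s (map +_ μ) m) ≈ᴹ sign a *ₗ s (contract (map +_ μ) a) (m ℤ.- + 1)
  ψ*-column μ n m a l index = ≈ᴹ-trans
    (ψ*-s n α m N (ℕₚ.m≤m+n _ (suc a)))
    (contraction-single N (weight n m) (λ β → s β (m ℤ.- + 1)) α a (ℕₚ.m≤n+m (suc a) _) selected others)
    where
    α = map +_ μ
    N = length α ℕ.+ ℤ.∣ n ℤ.- m ℤ.- + 1 ∣ ℕ.+ suc a

    entry-map : ∀ μ t → entry (map +_ μ) t ≡ + Exponents.exponent μ t
    entry-map []      t       = ≡.refl
    entry-map (b ∷ μ) zero    = ≡.refl
    entry-map (b ∷ μ) (suc t) = entry-map μ t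

    row : ∀ t → entry α t ≡ + 0 → ℤ.pred (entry α t ℤ.- + t) ≡ -[1+ t ]
    row t eq = ≡.trans (≡.cong (λ e → ℤ.pred (e ℤ.- + t)) eq) (≡.sym (ℤₚ.minus-suc (+ 0) t))

    beyond : ∀ t → a ℕ.≤ t → entry α t ≡ + 0
    beyond t a≤t = entry-beyond α t
      (≡.subst (ℕ._≤ t) (≡.sym (Listₚ.length-map +_ μ)) (ℕₚ.≤-trans l a≤t))

    selected : weight n m (entry α a ℤ.- + a) K.≈ K.1#
    selected = δ-≡ (≡.trans index (≡.sym (row a (beyond a ℕₚ.≤-refl))))

    add-back : ∀ e t → (- + 1) ℤ.+ (e ℤ.- t) ℤ.+ (+ 1 ℤ.+ t) ≡ e
    add-back = solve-∀

    others : ∀ t → t ≢ a → weight n m (entry α t ℤ.- + t) K.≈ K.0#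
    others t t≢a = δ-≢ (n ℤ.- m ℤ.- + 1) (ℤ.pred (entry α t ℤ.- + t)) λ eq →
      contra (≡.trans (≡.sym index) eq)
      where
      contra : -[1+ a ] ≢ ℤ.pred (entry α t ℤ.- + t)
      contra eq with a ℕₚ.≤? t
      ... | yes a≤t = t≢a (≡.sym (ℤₚ.-[1+-injective (≡.trans eq (row t (beyond t a≤t)))))
      -- For t < a the equation would force the entry to be t - a, which is negative, but entries of
      -- `α` are natural numbers.
      ... | no a≰t  = negative (≡.trans (≡.sym (ℤₚ.⊖-< (s<s (ℕₚ.≰⇒> a≰t)))) (≡.trans
          (≡.cong (ℤ._+ + suc t) eq)
          (≡.trans (add-back (entry α t) (+ t)) (entry-map μ t))))
        where
        negative : ∀ {j} → - + (a ℕ.∸ t) ≢ + j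
        negative eq with a ℕ.∸ t | ℕₚ.m<n⇒0<n∸m (ℕₚ.≰⇒> a≰t)
        negative () | suc _ | _

  -- The operator deletes the zero entry at place `a` of the conjugate: this lengthens the first `a`
  -- columns by a box and contributes (-1)^a. Over all rows these signs multiply to (-1)^|λ|.
  ψ*-conjugate : ∀ a β → Linked _≥_ (a ∷ β) →
    ψ* (- + a ℤ.- + length β) (sign (sum β) *ₗ s (map +_ (conjugate β)) (- + length β)) ≈ᴹ
    sign (sum (a ∷ β)) *ₗ s (map +_ (conjugate (a ∷ β))) (- + suc (length β))
  ψ*-conjugate a β a∷β↓ = begin
    ψ* k (sign (sum β) *ₗ s (map +_ (conjugate β)) (- + n))
      ≈⟨ ψ*-linear k .*ₗ-homo _ _ ⟩
    sign (sum β) *ₗ ψ* k (s (map +_ (conjugate β)) (- + n))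
      ≈⟨ *ₗ-congˡ (ψ*-column (conjugate β) k (- + n) a (length-conjugate a∷β↓) index≡) ⟩
    sign (sum β) *ₗ (sign a *ₗ s (contract (map +_ (conjugate β)) a) (- + n ℤ.- + 1))
      ≈⟨ *ₗ-assoc _ _ _ ⟨
    (sign (sum β) K.* sign a) *ₗ s (contract (map +_ (conjugate β)) a) (- + n ℤ.- + 1)
      ≈⟨ *ₗ-cong (K.trans (K.*-comm _ _) (K.sym (^-homo-* (K.- K.1#) a (sum β))))
           (≈ᴹ-reflexive (≡.cong₂ s (contract-conjugate a∷β↓) exponent)) ⟩
    sign (a ℕ.+ sum β) *ₗ s (map +_ (conjugate (a ∷ β))) (- + suc n) ∎
    where
    n = length β
    k = - + a ℤ.- + n

    index : ∀ a n → - a ℤ.- n ℤ.- (- n) ℤ.- + 1 ≡ (- + 1) ℤ.+ (- a)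
    index = solve-∀

    index≡ : k ℤ.- (- + n) ℤ.- + 1 ≡ -[1+ a ]
    index≡ = ≡.trans (index (+ a) (+ n)) (≡.sym (ℤₚ.neg-suc a))

    exponent : - + n ℤ.- + 1 ≡ - + suc n
    exponent = ≡.trans (ℤₚ.+-comm (- + n) (- + 1)) (≡.sym (ℤₚ.neg-suc n))

-- Specialization to B[z, z⁻¹] and the Schur family.

module FermionRelations (K : CommutativeRing c ℓ) {h : ℤ → ℤ → PolynomialRing.B.Carrier K}
                        (isSchurFamily : PolynomialRing.IsSchurFamily K h) where
  open PolynomialRing K using (B-ring; module IsSchurFamily)
  open IsSchurFamily isSchurFamily
  open Fermions K isSchurFamily

  s-straightenable : ∀ m → Straightening.Straightenable K 𝓑 (λ α → s α z^ m)
  s-straightenable m = straightenable-map {N = 𝓑} (_z^ m)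
    (λ x≈y → Laurent.single-cong x≈y ≡.refl) (λ x y → Laurent.single-+ x y m) (Laurent.single-0 m)
    (JacobiTrudi.jacobiTrudi-straightenable B-ring (record { diagonal = normalised ; below = vanishing }))

  private module F = Fock K 𝓑 (λ α m → s α z^ m) s-straightenable basis
  open F public using (ψψ; ψ*ψ*; ψψ*)
  open LeftModule 𝓑 using (≈ᴹ-refl; ≈ᴹ-sym; ≈ᴹ-trans; *ₗ-identityˡ)

  creation : ∀ α → foldr ψ 1𝓑 (creation-indices α) ≈ᴹ s (map +_ α) z^ (+ length α)
  creation []      = ≈ᴹ-refl {1𝓑}
  creation (a ∷ α) = ≈ᴹ-trans
    (Linear.IsLinear.cong (F.ψ-linear (+ a ℤ.+ + suc (length α))) (creation α)) (F.ψ-row a α)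

  annihilation : ∀ α → Linked _≥_ α → foldr ψ* 1𝓑 (annihilation-indices α) ≈ᴹ
                 sign (sum α) *ₗ s (map +_ (conjugate α)) z^ (- (+ length α))
  annihilation []      _  = ≈ᴹ-sym (*ₗ-identityˡ 1𝓑)
  annihilation (a ∷ α) α↓ = ≈ᴹ-trans
    (Linear.IsLinear.cong (F.ψ*-linear (- + a ℤ.- + length α)) (annihilation α (Linked.tail α↓)))
    (F.ψ*-conjugate a α α↓)

proposition4p1 : ∀ {c ℓ} (K : CommutativeRing c ℓ) (h : ℤ → ℤ → PolynomialRing.B.Carrier K)
    (isSchurFamily : PolynomialRing.IsSchurFamily K h) →
    let open Fermions K isSchurFamily in
    ((∀ k l x → ψ k (ψ l x) +ᴹ ψ l (ψ k x) ≈ᴹ 0ᴹ)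
    × (∀ k l x → ψ* k (ψ* l x) +ᴹ ψ* l (ψ* k x) ≈ᴹ 0ᴹ)
    × (∀ k l x → ψ k (ψ* l x) +ᴹ ψ* l (ψ k x) ≈ᴹ δ k l *ₗ x))
    × (∀ (α : List ℕ) → Linked _≥_ α →
    (foldr ψ 1𝓑 (creation-indices α) ≈ᴹ s (map +_ α) z^ (+ length α))
    × (foldr ψ* 1𝓑 (annihilation-indices α)
    ≈ᴹ sign (sum α) *ₗ s (map +_ (conjugate α)) z^ (- (+ length α))))
proposition4p1 K h isSchurFamily =
  (ψψ , ψ*ψ* , ψψ*) , λ α α↓ → creation α , annihilation α α↓
  where open FermionRelations K isSchurFamily
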